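{- Let $G$ be a graph of order $n$ with minimum degree $\delta>0$ and matching number $\beta_1=\beta_1(G)$. Then $$ \gamma_r(G)\le\frac{2\ln(\delta+1)+\delta+3}{\delta+1}\,n-2\beta_1 $$ and $$ \gamma_{\mathrm{tr}}(G)\le\frac{2\ln\delta+\delta+2}{\delta}\,n-2\beta_1 . $$
   Context: All graphs are finite and undirected, without loops or multiple edges. The matching number $\beta_1(G)$ is the largest number of pairwise non-adjacent edges in $G$. A set $X\subseteq V(G)$ is a dominating set of $G$ if every vertex not in $X$ is adjacent to a vertex in $X$. A dominating set $X$ is a restrained dominating set if every vertex in $V(G)-X$ is adjacent to a vertex in $V(G)-X$; $\gamma_r(G)$ is the minimum cardinality of a restrained dominating set. A restrained dominating set $X$ is a total restrained dominating set if, in addition, every vertex of $X$ is adjacent to a vertex of $X$; $\gamma_{\mathrm{tr}}(G)$ is the minimum cardinality of a total restrained dominating set. -}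

module Defs where

open import Data.Fin using (Fin; fromℕ<)
open import Data.Fin.Properties using (all?; any?; injective⇒≤) renaming (_≟_ to _≟ᶠ_)
open import Data.Fin.Subset using (Subset; _∈_; _∉_; ∣_∣; ⊤; Nonempty)
open import Data.Fin.Subset.Properties using (_∈?_; ∈⊤; anySubset?; nonempty?; Empty-unique; ∣⊥∣≡0)
import Data.Integer as ℤ
import Data.Integer.Properties as ℤ
open import Data.Integer.Tactic.RingSolver using (solve-∀)
open import Data.Nat as ℕ using (ℕ; zero; suc; NonZero)
import Data.Nat.Properties as ℕ
open import Data.Nat.Coprimality using (1-coprimeTo)
open import Data.Product using (∃; _×_; _,_; proj₁; proj₂)
open import Data.Rational as ℚ using (ℚ; 0ℚ; 1ℚ; ½; mkℚ; *<*; *≤*)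
import Data.Rational.Properties as ℚ
open import Data.Rational.Solver using (module +-*-Solver)
import Data.Rational.Unnormalised as ℚᵘ
import Data.Rational.Unnormalised.Properties as ℚᵘ
open import Data.Sum using (inj₁; inj₂)
open import Data.Vec using (Vec; []; _∷_; lookup; tabulate)
open import Data.Vec.Properties using (lookup∘tabulate; []=⇒lookup)
open import Level using (0ℓ)
open import Relation.Binary using (Rel; Symmetric) renaming (Decidable to Decidable₂)
open import Relation.Binary.PropositionalEquality
open import Relation.Nullary using (¬_; Dec; yes; no; does; contradiction; map′; ¬?; _×-dec_; _→-dec_)
open import Relation.Unary using (Pred; Decidable)

IsLeast IsGreatest : Pred ℕ 0ℓ → Pred ℕ 0ℓ
IsLeast    P m = P m × (∀ k → P k → m ℕ.≤ k)
IsGreatest P m = P m × (∀ k → P k → k ℕ.≤ m)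

least : {P : Pred ℕ 0ℓ} → Decidable P → ∃ P → ∃ (IsLeast P)
least {P} P? (n , Pn) = go P? n Pn
  where
  go : {Q : Pred ℕ 0ℓ} → Decidable Q → ∀ n → Q n → ∃ (IsLeast Q)
  go Q? n Qn with Q? 0
  go Q? n       Qn | yes Q0 = 0 , Q0 , λ _ _ → ℕ.z≤n
  go Q? zero    Qn | no ¬Q0 = contradiction Qn ¬Q0
  go {Q} Q? (suc n) Qn | no ¬Q0 with go (λ k → Q? (suc k)) n Qn
  ... | m , Qm , minimal = suc m , Qm , lower
    where
    lower : ∀ k → Q k → suc m ℕ.≤ k
    lower zero    Q0 = contradiction Q0 ¬Q0
    lower (suc k) Qk = ℕ.s≤s (minimal k Qk)

greatest : {P : Pred ℕ 0ℓ} → Decidable P → P 0 →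
           ∀ b → (∀ k → P k → k ℕ.≤ b) → ∃ (IsGreatest P)
greatest P? P0 zero    bound = 0 , P0 , bound
greatest {P} P? P0 (suc b) bound with P? (suc b)
... | yes Pb = suc b , Pb , bound
... | no ¬Pb = greatest P? P0 b bound′
  where
  bound′ : ∀ k → P k → k ℕ.≤ b
  bound′ k Pk = ℕ.≤-pred (ℕ.≤∧≢⇒< (bound k Pk) λ { refl → ¬Pb Pk })

-- Finiteness of the edge set is read constructively, as decidability of
-- adjacency.
record Graph (n : ℕ) : Set₁ where
  field
    _~_    : Rel (Fin n) 0ℓ
    _~?_   : Decidable₂ _~_
    ~-sym  : Symmetric _~_
    ~-irrefl : ∀ {v} → ¬ (v ~ v)

module _ {n : ℕ} (G : Graph n) where
  open Graph G

  neighbours : Fin n → Subset n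
  neighbours v = tabulate (λ u → does (v ~? u))

  degree : Fin n → ℕ
  degree v = ∣ neighbours v ∣

  private
    HasDegree : Pred ℕ 0ℓ
    HasDegree k = ∃ λ v → degree v ≡ k

    -- The graph with no vertices has no minimum degree.
    minDegree : .{{_ : NonZero n}} → ∃ (IsLeast HasDegree)
    minDegree = least (λ k → any? λ v → degree v ℕ.≟ k)
                      (_ , fromℕ< (ℕ.>-nonZero⁻¹ n) , refl)

  δ : .{{_ : NonZero n}} → ℕ
  δ = proj₁ minDegree

  δ-isLeast : .{{_ : NonZero n}} → IsLeast (λ k → ∃ λ v → degree v ≡ k) δ
  δ-isLeast = proj₂ minDegree

  -- An edge is given by an ordered pair of adjacent vertices.  Non-adjacent
  -- edges share no end, so (u , v) and (v , u) never occur together in a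
  -- matching and sizes agree with those of sets of unordered edges.
  IsEdge : Pred (Fin n × Fin n) 0ℓ
  IsEdge (u , v) = u ~ v

  NonAdjacent : Rel (Fin n × Fin n) 0ℓ
  NonAdjacent (u , v) (x , y) = (u ≢ x × u ≢ y) × (v ≢ x × v ≢ y)

  IsMatching : ∀ {k} → Pred (Vec (Fin n × Fin n) k) 0ℓ
  IsMatching M = (∀ i → IsEdge (lookup M i))
               × (∀ i j → i ≢ j → NonAdjacent (lookup M i) (lookup M j))

  HasMatching : Pred ℕ 0ℓ
  HasMatching k = ∃ λ (M : Vec (Fin n × Fin n) k) → IsMatching M

  private
    anyVec? : ∀ {k} {P : Pred (Vec (Fin n × Fin n) k) 0ℓ} → Decidable P → Dec (∃ P)
    anyVec? {zero}  P? = map′ (λ p → [] , p) (λ { ([] , p) → p }) (P? [])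
    anyVec? {suc k} P? =
      map′ (λ { (u , v , M , p) → (u , v) ∷ M , p })
           (λ { ((u , v) ∷ M , p) → u , v , M , p })
           (any? λ u → any? λ v → anyVec? λ M → P? ((u , v) ∷ M))

    nonAdjacent? : Decidable₂ NonAdjacent
    nonAdjacent? (u , v) (x , y) = (¬? (u ≟ᶠ x) ×-dec ¬? (u ≟ᶠ y))
                            ×-dec (¬? (v ≟ᶠ x) ×-dec ¬? (v ≟ᶠ y))

    isMatching? : ∀ {k} → Decidable (IsMatching {k})
    isMatching? M =
      all? (λ i → proj₁ (lookup M i) ~? proj₂ (lookup M i))
      ×-dec all? (λ i → all? λ j → ¬? (i ≟ᶠ j) →-dec nonAdjacent? (lookup M i) (lookup M j))

    matching-bound : ∀ k → HasMatching k → k ℕ.≤ n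
    matching-bound k (M , _ , apart) = injective⇒≤ {f = end} injective
      where
      end : Fin k → Fin n
      end i = proj₁ (lookup M i)

      injective : ∀ {i j} → end i ≡ end j → i ≡ j
      injective {i} {j} eq with i ≟ᶠ j
      ... | yes i≡j = i≡j
      ... | no  i≢j = contradiction eq (proj₁ (proj₁ (apart i j i≢j)))

    maxMatching : ∃ (IsGreatest HasMatching)
    maxMatching = greatest (λ k → anyVec? isMatching?)
                           ([] , (λ ()) , λ ()) n matching-bound

  β₁ : ℕ
  β₁ = proj₁ maxMatching

  β₁-isGreatest : IsGreatest HasMatching β₁
  β₁-isGreatest = proj₂ maxMatching

  IsDominating : Pred (Subset n) 0ℓ
  IsDominating X = ∀ v → v ∉ X → ∃ λ u → u ∈ X × v ~ u

  IsRestrainedDominating : Pred (Subset n) 0ℓ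
  IsRestrainedDominating X =
    IsDominating X × (∀ v → v ∉ X → ∃ λ u → u ∉ X × v ~ u)

  IsTotalRestrainedDominating : Pred (Subset n) 0ℓ
  IsTotalRestrainedDominating X =
    IsRestrainedDominating X × (∀ v → v ∈ X → ∃ λ u → u ∈ X × v ~ u)

  HasSize : Pred (Subset n) 0ℓ → Pred ℕ 0ℓ
  HasSize P k = ∃ λ X → P X × ∣ X ∣ ≡ k

  private
    restrained? : Decidable IsRestrainedDominating
    restrained? X =
      all? (λ v → ¬? (v ∈? X) →-dec any? λ u → (u ∈? X) ×-dec (v ~? u))
      ×-dec all? (λ v → ¬? (v ∈? X) →-dec any? λ u → ¬? (u ∈? X) ×-dec (v ~? u))

    totalRestrained? : Decidable IsTotalRestrainedDominating
    totalRestrained? X =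
      restrained? X ×-dec all? (λ v → (v ∈? X) →-dec any? λ u → (u ∈? X) ×-dec (v ~? u))

    minSize : {P : Pred (Subset n) 0ℓ} → Decidable P → ∃ P → ∃ (IsLeast (HasSize P))
    minSize P? (X , PX) =
      least (λ k → anySubset? λ Y → P? Y ×-dec (∣ Y ∣ ℕ.≟ k)) (_ , X , PX , refl)

    ⊤-restrained : IsRestrainedDominating ⊤
    ⊤-restrained = (λ v v∉⊤ → contradiction ∈⊤ v∉⊤) , (λ v v∉⊤ → contradiction ∈⊤ v∉⊤)

    minRestrained : ∃ (IsLeast (HasSize IsRestrainedDominating))
    minRestrained = minSize restrained? (⊤ , ⊤-restrained)

    hasNeighbour : ∀ v → degree v ≢ 0 → ∃ λ u → v ~ u
    hasNeighbour v deg≢0 with nonempty? (neighbours v)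
    ... | no empty = contradiction (trans (cong ∣_∣ (Empty-unique empty)) (∣⊥∣≡0 n)) deg≢0
    ... | yes (u , u∈N) = u , adjacent
      where
      adjacent : v ~ u
      adjacent with v ~? u | trans (sym (lookup∘tabulate (λ w → does (v ~? w)) u)) ([]=⇒lookup u∈N)
      ... | yes v~u | _  = v~u
      ... | no  _   | ()

    ⊤-totalRestrained : .{{_ : NonZero n}} .{{_ : NonZero δ}} → IsTotalRestrainedDominating ⊤
    ⊤-totalRestrained = ⊤-restrained , λ v _ → inside v (hasNeighbour v (positive v))
      where
      positive : ∀ v → degree v ≢ 0
      positive v = ℕ.m<n⇒n≢0 (ℕ.≤-trans (ℕ.>-nonZero⁻¹ δ) (proj₂ δ-isLeast _ (v , refl)))

      inside : ∀ v → (∃ λ u → v ~ u) → ∃ λ u → u ∈ ⊤ × v ~ u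
      inside v (u , v~u) = u , ∈⊤ , v~u

    minTotalRestrained : .{{_ : NonZero n}} .{{_ : NonZero δ}} →
                         ∃ (IsLeast (HasSize IsTotalRestrainedDominating))
    minTotalRestrained = minSize totalRestrained? (⊤ , ⊤-totalRestrained)

  γᵣ : ℕ
  γᵣ = proj₁ minRestrained

  γᵣ-isLeast : IsLeast (HasSize IsRestrainedDominating) γᵣ
  γᵣ-isLeast = proj₂ minRestrained

  -- A graph with an isolated vertex has no total restrained dominating set.
  γₜᵣ : .{{_ : NonZero n}} .{{_ : NonZero δ}} → ℕ
  γₜᵣ = proj₁ minTotalRestrained

  γₜᵣ-isLeast : .{{_ : NonZero n}} .{{_ : NonZero δ}} →
                IsLeast (HasSize IsTotalRestrainedDominating) γₜᵣ
  γₜᵣ-isLeast = proj₂ minTotalRestrained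

IsCauchy : Pred (ℕ → ℚ) 0ℓ
IsCauchy x = ∀ ε → 0ℚ ℚ.< ε → ∃ λ N → ∀ i j → N ℕ.≤ i → N ℕ.≤ j → ℚ.∣ x i ℚ.- x j ∣ ℚ.≤ ε

record ℝ : Set where
  constructor mkℝ
  field
    seq    : ℕ → ℚ
    cauchy : IsCauchy seq

open ℝ

infix  4 _≤ᴿ_
infixl 6 _+ᴿ_ _-ᴿ_
infixl 7 _*ᴿ_ _/ᴿ_

_≤ᴿ_ : Rel ℝ 0ℓ
x ≤ᴿ y = ∀ ε → 0ℚ ℚ.< ε → ∃ λ N → ∀ i → N ℕ.≤ i → seq x i ℚ.≤ seq y i ℚ.+ ε

private
  ½+½ : ∀ ε → ½ ℚ.* ε ℚ.+ ½ ℚ.* ε ≡ ε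
  ½+½ ε = trans (sym (ℚ.*-distribʳ-+ ε ½ ½)) (ℚ.*-identityˡ ε)

  split : ∀ r ε → 0ℚ ℚ.< r → 0ℚ ℚ.< ε → ∃ λ η → 0ℚ ℚ.< η × r ℚ.* η ≡ ½ ℚ.* ε
  split r ε 0<r 0<ε = η , ℚ.positive⁻¹ η , eq
    where
    instance
      r-pos : ℚ.Positive r
      r-pos = ℚ.positive 0<r
      ε-pos : ℚ.Positive ε
      ε-pos = ℚ.positive 0<ε
      r-nz : ℚ.NonZero r
      r-nz = ℚ.pos⇒nonZero r
      1/r-pos : ℚ.Positive (ℚ.1/ r)
      1/r-pos = ℚ.1/pos⇒pos r
      ½ε-pos : ℚ.Positive (½ ℚ.* ε)
      ½ε-pos = ℚ.pos*pos⇒pos ½ ε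
    η : ℚ
    η = (ℚ.1/ r) ℚ.* (½ ℚ.* ε)
    instance
      η-pos : ℚ.Positive η
      η-pos = ℚ.pos*pos⇒pos (ℚ.1/ r) (½ ℚ.* ε)
    eq : r ℚ.* η ≡ ½ ℚ.* ε
    eq = trans (sym (ℚ.*-assoc r (ℚ.1/ r) (½ ℚ.* ε)))
           (trans (cong (ℚ._* (½ ℚ.* ε)) (ℚ.*-inverseʳ r)) (ℚ.*-identityˡ (½ ℚ.* ε)))

  half : ∀ ε → 0ℚ ℚ.< ε → 0ℚ ℚ.< ½ ℚ.* ε
  half ε 0<ε = ℚ.positive⁻¹ (½ ℚ.* ε) {{ℚ.pos*pos⇒pos ½ ε {{ℚ.positive 0<ε}}}}

  Bounded : (ℕ → ℚ) → Set
  Bounded x = ∃ λ N → ∃ λ A → 0ℚ ℚ.< A × (∀ i → N ℕ.≤ i → ℚ.∣ x i ∣ ℚ.≤ A)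

  bounded : ∀ {x} → IsCauchy x → Bounded x
  bounded {x} cx with cx 1ℚ (ℚ.positive⁻¹ 1ℚ)
  ... | N , close = N , A , 0<A , below
    where
    A : ℚ
    A = ℚ.∣ x N ∣ ℚ.+ 1ℚ
    0<A : 0ℚ ℚ.< A
    0<A = ℚ.+-mono-≤-< (ℚ.0≤∣p∣ (x N)) (ℚ.positive⁻¹ 1ℚ)
    below : ∀ i → N ℕ.≤ i → ℚ.∣ x i ∣ ℚ.≤ A
    below i N≤i = begin
      ℚ.∣ x i ∣                            ≡⟨ cong ℚ.∣_∣ (solve 2 (λ a b → a := b :+ (a :- b)) refl (x i) (x N)) ⟩
      ℚ.∣ x N ℚ.+ (x i ℚ.- x N) ∣          ≤⟨ ℚ.∣p+q∣≤∣p∣+∣q∣ (x N) (x i ℚ.- x N) ⟩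
      ℚ.∣ x N ∣ ℚ.+ ℚ.∣ x i ℚ.- x N ∣      ≤⟨ ℚ.+-monoʳ-≤ ℚ.∣ x N ∣ (close i N N≤i ℕ.≤-refl) ⟩
      A                                    ∎
      where
      open ℚ.≤-Reasoning
      open +-*-Solver

  +-cauchy : ∀ {x y} → IsCauchy x → IsCauchy y → IsCauchy (λ i → x i ℚ.+ y i)
  +-cauchy {x} {y} cx cy ε 0<ε with cx (½ ℚ.* ε) (half ε 0<ε) | cy (½ ℚ.* ε) (half ε 0<ε)
  ... | N , close-x | M , close-y = N ℕ.⊔ M , close
    where
    close : ∀ i j → N ℕ.⊔ M ℕ.≤ i → N ℕ.⊔ M ℕ.≤ j →
            ℚ.∣ (x i ℚ.+ y i) ℚ.- (x j ℚ.+ y j) ∣ ℚ.≤ ε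
    close i j i≥ j≥ = begin
      ℚ.∣ (x i ℚ.+ y i) ℚ.- (x j ℚ.+ y j) ∣
        ≡⟨ cong ℚ.∣_∣ (solve 4 (λ a b c d → (a :+ b) :- (c :+ d) := (a :- c) :+ (b :- d))
                         refl (x i) (y i) (x j) (y j)) ⟩
      ℚ.∣ (x i ℚ.- x j) ℚ.+ (y i ℚ.- y j) ∣
        ≤⟨ ℚ.∣p+q∣≤∣p∣+∣q∣ (x i ℚ.- x j) (y i ℚ.- y j) ⟩
      ℚ.∣ x i ℚ.- x j ∣ ℚ.+ ℚ.∣ y i ℚ.- y j ∣
        ≤⟨ ℚ.+-mono-≤ (close-x i j (ℕ.m⊔n≤o⇒m≤o N M i≥) (ℕ.m⊔n≤o⇒m≤o N M j≥))
                      (close-y i j (ℕ.m⊔n≤o⇒n≤o N M i≥) (ℕ.m⊔n≤o⇒n≤o N M j≥)) ⟩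
      ½ ℚ.* ε ℚ.+ ½ ℚ.* ε
        ≡⟨ ½+½ ε ⟩
      ε ∎
      where
      open ℚ.≤-Reasoning
      open +-*-Solver

  neg-cauchy : ∀ {x} → IsCauchy x → IsCauchy (λ i → ℚ.- x i)
  neg-cauchy {x} cx ε 0<ε with cx ε 0<ε
  ... | N , close = N , λ i j i≥ j≥ → subst (ℚ._≤ ε) (flip i j) (close i j i≥ j≥)
    where
    flip : ∀ i j → ℚ.∣ x i ℚ.- x j ∣ ≡ ℚ.∣ ℚ.- x i ℚ.- ℚ.- x j ∣
    flip i j = trans (sym (ℚ.∣-p∣≡∣p∣ (x i ℚ.- x j)))
                 (cong ℚ.∣_∣ (solve 2 (λ a b → :- (a :- b) := (:- a) :- (:- b)) refl (x i) (x j)))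
      where open +-*-Solver

  *-mono-∣∣ : ∀ p q {A η} → ℚ.∣ p ∣ ℚ.≤ A → ℚ.∣ q ∣ ℚ.≤ η → ℚ.∣ p ℚ.* q ∣ ℚ.≤ A ℚ.* η
  *-mono-∣∣ p q {A} {η} p≤A q≤η = begin
    ℚ.∣ p ℚ.* q ∣          ≡⟨ ℚ.∣p*q∣≡∣p∣*∣q∣ p q ⟩
    ℚ.∣ p ∣ ℚ.* ℚ.∣ q ∣    ≤⟨ ℚ.*-monoʳ-≤-nonNeg ℚ.∣ q ∣ {{ℚ.∣-∣-nonNeg q}} p≤A ⟩
    A ℚ.* ℚ.∣ q ∣          ≤⟨ ℚ.*-monoˡ-≤-nonNeg A {{ℚ.nonNegative (ℚ.≤-trans (ℚ.0≤∣p∣ p) p≤A)}} q≤η ⟩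
    A ℚ.* η                ∎
    where open ℚ.≤-Reasoning

  product-difference : ∀ a b c d → a ℚ.* b ℚ.- c ℚ.* d ≡ a ℚ.* (b ℚ.- d) ℚ.+ d ℚ.* (a ℚ.- c)
  product-difference = solve 4 (λ a b c d → a :* b :- c :* d := a :* (b :- d) :+ d :* (a :- c)) refl
    where open +-*-Solver

  product-bound : ∀ a b c d {A B η θ ε} →
    ℚ.∣ a ∣ ℚ.≤ A → ℚ.∣ d ∣ ℚ.≤ B → ℚ.∣ b ℚ.- d ∣ ℚ.≤ η → ℚ.∣ a ℚ.- c ∣ ℚ.≤ θ →
    A ℚ.* η ≡ ½ ℚ.* ε → B ℚ.* θ ≡ ½ ℚ.* ε → ℚ.∣ a ℚ.* b ℚ.- c ℚ.* d ∣ ℚ.≤ ε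
  product-bound a b c d {A} {B} {η} {θ} {ε} a≤A d≤B b-d≤η a-c≤θ Aη Bθ =
    subst₂ ℚ._≤_ (cong ℚ.∣_∣ (sym (product-difference a b c d)))
                 (trans (cong₂ ℚ._+_ Aη Bθ) (½+½ ε))
      (ℚ.≤-trans (ℚ.∣p+q∣≤∣p∣+∣q∣ (a ℚ.* (b ℚ.- d)) (d ℚ.* (a ℚ.- c)))
                 (ℚ.+-mono-≤ (*-mono-∣∣ a (b ℚ.- d) a≤A b-d≤η) (*-mono-∣∣ d (a ℚ.- c) d≤B a-c≤θ)))

  -- Auxiliary functions are used instead of with-abstraction, which is very
  -- slow here because it normalises products of rationals.
  *-cauchy : ∀ {x y} → IsCauchy x → IsCauchy y → IsCauchy (λ i → x i ℚ.* y i)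
  *-cauchy {x} {y} cx cy ε 0<ε = from-bounds (bounded cx) (bounded cy)
    where
    Close : (ℕ → ℚ) → ℚ → Set
    Close z η = ∃ λ N → ∀ i j → N ℕ.≤ i → N ℕ.≤ j → ℚ.∣ z i ℚ.- z j ∣ ℚ.≤ η

    finish : ∀ {A B η θ} K L →
             (∀ i → K ℕ.≤ i → ℚ.∣ x i ∣ ℚ.≤ A) → (∀ i → L ℕ.≤ i → ℚ.∣ y i ∣ ℚ.≤ B) →
             A ℚ.* η ≡ ½ ℚ.* ε → B ℚ.* θ ≡ ½ ℚ.* ε →
             Close x θ → Close y η → Close (λ i → x i ℚ.* y i) ε
    finish K L x≤A y≤B Aη Bθ (N , close-x) (M , close-y) =
      (K ℕ.⊔ L) ℕ.⊔ (N ℕ.⊔ M) , λ i j i≥ j≥ →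
        product-bound (x i) (y i) (x j) (y j)
          (x≤A i (ℕ.m⊔n≤o⇒m≤o K L (outer i≥)))
          (y≤B j (ℕ.m⊔n≤o⇒n≤o K L (outer j≥)))
          (close-y i j (ℕ.m⊔n≤o⇒n≤o N M (inner i≥)) (ℕ.m⊔n≤o⇒n≤o N M (inner j≥)))
          (close-x i j (ℕ.m⊔n≤o⇒m≤o N M (inner i≥)) (ℕ.m⊔n≤o⇒m≤o N M (inner j≥)))
          Aη Bθ
      where
      outer : ∀ {o} → (K ℕ.⊔ L) ℕ.⊔ (N ℕ.⊔ M) ℕ.≤ o → K ℕ.⊔ L ℕ.≤ o
      outer = ℕ.m⊔n≤o⇒m≤o (K ℕ.⊔ L) (N ℕ.⊔ M)
      inner : ∀ {o} → (K ℕ.⊔ L) ℕ.⊔ (N ℕ.⊔ M) ℕ.≤ o → N ℕ.⊔ M ℕ.≤ o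
      inner = ℕ.m⊔n≤o⇒n≤o (K ℕ.⊔ L) (N ℕ.⊔ M)

    from-splits : ∀ {A B} K L →
      (∀ i → K ℕ.≤ i → ℚ.∣ x i ∣ ℚ.≤ A) → (∀ i → L ℕ.≤ i → ℚ.∣ y i ∣ ℚ.≤ B) →
      (∃ λ η → 0ℚ ℚ.< η × A ℚ.* η ≡ ½ ℚ.* ε) → (∃ λ θ → 0ℚ ℚ.< θ × B ℚ.* θ ≡ ½ ℚ.* ε) →
      Close (λ i → x i ℚ.* y i) ε
    from-splits K L x≤A y≤B (η , 0<η , Aη) (θ , 0<θ , Bθ) =
      finish K L x≤A y≤B Aη Bθ (cx θ 0<θ) (cy η 0<η)

    from-bounds : Bounded x → Bounded y → Close (λ i → x i ℚ.* y i) ε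
    from-bounds (K , A , 0<A , x≤A) (L , B , 0<B , y≤B) =
      from-splits K L x≤A y≤B (split A ε 0<A 0<ε) (split B ε 0<B 0<ε)

fromℚ : ℚ → ℝ
fromℚ q = mkℝ (λ _ → q) λ ε 0<ε → 0 , λ _ _ _ _ →
  subst (ℚ._≤ ε) (cong ℚ.∣_∣ (sym (ℚ.+-inverseʳ q))) (ℚ.<⇒≤ 0<ε)

fromℕ : ℕ → ℝ
fromℕ k = fromℚ (ℤ.+ k ℚ./ 1)

_+ᴿ_ _-ᴿ_ _*ᴿ_ : ℝ → ℝ → ℝ
x +ᴿ y = mkℝ (λ i → seq x i ℚ.+ seq y i) (+-cauchy {seq x} {seq y} (cauchy x) (cauchy y))
x -ᴿ y = mkℝ (λ i → seq x i ℚ.- seq y i)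
           (+-cauchy {seq x} {λ i → ℚ.- seq y i} (cauchy x) (neg-cauchy {seq y} (cauchy y)))
x *ᴿ y = mkℝ (λ i → seq x i ℚ.* seq y i) (*-cauchy {seq x} {seq y} (cauchy x) (cauchy y))

_/ᴿ_ : ℝ → (k : ℕ) .{{_ : NonZero k}} → ℝ
x /ᴿ k = x *ᴿ fromℚ (ℤ.+ 1 ℚ./ k)

∑< : ℕ → (ℕ → ℚ) → ℚ
∑< zero    f = 0ℚ
∑< (suc n) f = ∑< n f ℚ.+ f n

-- 1/0 is set to 0; this value is never used below.
recip : ℕ → ℚ
recip zero    = 0ℚ
recip (suc d) = ℤ.+ 1 ℚ./ suc d

-- The left Riemann sum of ∫₁ᵐ dt/t for the partition of [1, m] into intervals
-- of length 1/N: it is the sum of (1/N) · 1/(1 + i/N) = 1/(N + i) over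
-- 0 ≤ i < (m - 1) N.
riemannSum : (m N : ℕ) → ℚ
riemannSum m N = ∑< ((m ℕ.∸ 1) ℕ.* N) (λ i → recip (N ℕ.+ i))

module RiemannSums where
  unit : ℕ → ℚ
  unit d = mkℚ (ℤ.+ 1) d (1-coprimeTo (suc d))

  recip-suc : ∀ d → recip (suc d) ≡ unit d
  recip-suc d = ℚ.normalize-coprime (1-coprimeTo (suc d))

  recip-nonNeg : ∀ d → 0ℚ ℚ.≤ recip d
  recip-nonNeg zero    = ℚ.≤-refl
  recip-nonNeg (suc d) = subst (0ℚ ℚ.≤_) (sym (recip-suc d)) (ℚ.nonNegative⁻¹ (unit d))

  recip-anti : ∀ {a b} .{{_ : NonZero a}} → a ℕ.≤ b → recip b ℚ.≤ recip a
  recip-anti {suc a} {suc b} a≤b =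
    subst₂ ℚ._≤_ (sym (recip-suc b)) (sym (recip-suc a))
      (*≤* (ℤ.*-monoˡ-≤-nonNeg (ℤ.+ 1) (ℤ.+≤+ a≤b)))

  unit-double : ∀ d → unit (suc (d ℕ.+ d)) ℚ.+ unit (suc (d ℕ.+ d)) ≡ unit d
  unit-double d = ℚ.toℚᵘ-injective
    (ℚᵘ.≃-trans (ℚ.toℚᵘ-homo-+ (unit (suc (d ℕ.+ d))) (unit (suc (d ℕ.+ d))))
                (ℚᵘ.*≡* (lemma (ℤ.+ d))))
    where
    lemma : ∀ z → (ℤ.+ 1 ℤ.* (ℤ.+ 2 ℤ.+ (z ℤ.+ z)) ℤ.+ ℤ.+ 1 ℤ.* (ℤ.+ 2 ℤ.+ (z ℤ.+ z))) ℤ.* (ℤ.+ 1 ℤ.+ z)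
                ≡ ℤ.+ 1 ℤ.* ((ℤ.+ 2 ℤ.+ (z ℤ.+ z)) ℤ.* (ℤ.+ 2 ℤ.+ (z ℤ.+ z)))
    lemma = solve-∀

  recip-double : ∀ a .{{_ : NonZero a}} → recip (a ℕ.+ a) ℚ.+ recip (a ℕ.+ a) ≡ recip a
  recip-double (suc d) = begin
    recip (suc d ℕ.+ suc d) ℚ.+ recip (suc d ℕ.+ suc d)
      ≡⟨ cong (λ k → recip (suc k) ℚ.+ recip (suc k)) (ℕ.+-suc d d) ⟩
    recip (suc (suc (d ℕ.+ d))) ℚ.+ recip (suc (suc (d ℕ.+ d)))
      ≡⟨ cong₂ ℚ._+_ (recip-suc (suc (d ℕ.+ d))) (recip-suc (suc (d ℕ.+ d))) ⟩
    unit (suc (d ℕ.+ d)) ℚ.+ unit (suc (d ℕ.+ d))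
      ≡⟨ unit-double d ⟩
    unit d
      ≡⟨ recip-suc d ⟨
    recip (suc d) ∎
    where open ≡-Reasoning

  ∑<-mono : ∀ n {f g : ℕ → ℚ} → (∀ i → f i ℚ.≤ g i) → ∑< n f ℚ.≤ ∑< n g
  ∑<-mono zero    f≤g = ℚ.≤-refl
  ∑<-mono (suc n) f≤g = ℚ.+-mono-≤ (∑<-mono n f≤g) (f≤g n)

  ∑<-pairs : ∀ n f → ∑< (n ℕ.+ n) f ≡ ∑< n (λ i → f (i ℕ.+ i) ℚ.+ f (suc (i ℕ.+ i)))
  ∑<-pairs zero    f = refl
  ∑<-pairs (suc n) f = begin
    ∑< (n ℕ.+ suc n) f ℚ.+ f (n ℕ.+ suc n)
      ≡⟨ cong (λ k → ∑< k f ℚ.+ f k) (ℕ.+-suc n n) ⟩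
    ∑< (n ℕ.+ n) f ℚ.+ f (n ℕ.+ n) ℚ.+ f (suc (n ℕ.+ n))
      ≡⟨ ℚ.+-assoc (∑< (n ℕ.+ n) f) (f (n ℕ.+ n)) (f (suc (n ℕ.+ n))) ⟩
    ∑< (n ℕ.+ n) f ℚ.+ (f (n ℕ.+ n) ℚ.+ f (suc (n ℕ.+ n)))
      ≡⟨ cong (ℚ._+ (f (n ℕ.+ n) ℚ.+ f (suc (n ℕ.+ n)))) (∑<-pairs n f) ⟩
    ∑< (suc n) (λ i → f (i ℕ.+ i) ℚ.+ f (suc (i ℕ.+ i))) ∎
    where open ≡-Reasoning

  lowerSum : ℕ → ℕ → ℚ
  lowerSum K N = ∑< K (λ i → recip (N ℕ.+ suc i))

  upperSum : ℕ → ℕ → ℚ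
  upperSum K N = ∑< K (λ i → recip (N ℕ.+ i))

  telescope : ∀ K N → upperSum K N ℚ.+ recip (N ℕ.+ K) ≡ lowerSum K N ℚ.+ recip N
  telescope zero    N = cong (λ k → 0ℚ ℚ.+ recip k) (ℕ.+-identityʳ N)
  telescope (suc K) N = trans (cong (ℚ._+ recip (N ℕ.+ suc K)) (telescope K N))
    (solve 3 (λ a b c → a :+ b :+ c := a :+ c :+ b) refl (lowerSum K N) (recip N) (recip (N ℕ.+ suc K)))
    where open +-*-Solver

  double-+ : ∀ N i → (N ℕ.+ i) ℕ.+ (N ℕ.+ i) ≡ (N ℕ.+ N) ℕ.+ (i ℕ.+ i)
  double-+ N i = interchange N i N i
    where open import Algebra.Properties.CommutativeSemigroup ℕ.+-commutativeSemigroup using (interchange)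

  nonZero-+ : ∀ N i .{{_ : NonZero N}} → NonZero (N ℕ.+ i)
  nonZero-+ (suc N) i = _

  upper-step : ∀ K N .{{_ : NonZero N}} → upperSum (K ℕ.+ K) (N ℕ.+ N) ℚ.≤ upperSum K N
  upper-step K N = ℚ.≤-trans
    (ℚ.≤-reflexive (∑<-pairs K (λ i → recip (N ℕ.+ N ℕ.+ i)))) (∑<-mono K term)
    where
    open ℚ.≤-Reasoning
    term : ∀ i → recip (N ℕ.+ N ℕ.+ (i ℕ.+ i)) ℚ.+ recip (N ℕ.+ N ℕ.+ suc (i ℕ.+ i)) ℚ.≤ recip (N ℕ.+ i)
    term i = begin
      recip (N ℕ.+ N ℕ.+ (i ℕ.+ i)) ℚ.+ recip (N ℕ.+ N ℕ.+ suc (i ℕ.+ i))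
        ≤⟨ ℚ.+-monoʳ-≤ (recip (N ℕ.+ N ℕ.+ (i ℕ.+ i)))
             (recip-anti {{nonZero-+ (N ℕ.+ N) (i ℕ.+ i) {{nonZero-+ N N}}}}
               (ℕ.+-monoʳ-≤ (N ℕ.+ N) (ℕ.n≤1+n (i ℕ.+ i)))) ⟩
      recip (N ℕ.+ N ℕ.+ (i ℕ.+ i)) ℚ.+ recip (N ℕ.+ N ℕ.+ (i ℕ.+ i))
        ≡⟨ cong (λ k → recip k ℚ.+ recip k) (double-+ N i) ⟨
      recip ((N ℕ.+ i) ℕ.+ (N ℕ.+ i)) ℚ.+ recip ((N ℕ.+ i) ℕ.+ (N ℕ.+ i))
        ≡⟨ recip-double (N ℕ.+ i) {{nonZero-+ N i}} ⟩
      recip (N ℕ.+ i) ∎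

  lower-step : ∀ K N .{{_ : NonZero N}} → lowerSum K N ℚ.≤ lowerSum (K ℕ.+ K) (N ℕ.+ N)
  lower-step K N = ℚ.≤-trans (∑<-mono K term)
    (ℚ.≤-reflexive (sym (∑<-pairs K (λ i → recip (N ℕ.+ N ℕ.+ suc i)))))
    where
    open ℚ.≤-Reasoning
    term : ∀ i → recip (N ℕ.+ suc i)
             ℚ.≤ recip (N ℕ.+ N ℕ.+ suc (i ℕ.+ i)) ℚ.+ recip (N ℕ.+ N ℕ.+ suc (suc (i ℕ.+ i)))
    term i = begin
      recip (N ℕ.+ suc i)
        ≡⟨ recip-double (N ℕ.+ suc i) {{nonZero-+ N (suc i)}} ⟨
      recip ((N ℕ.+ suc i) ℕ.+ (N ℕ.+ suc i)) ℚ.+ recip ((N ℕ.+ suc i) ℕ.+ (N ℕ.+ suc i))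
        ≡⟨ cong (λ k → recip k ℚ.+ recip k)
             (trans (double-+ N (suc i)) (cong (λ k → N ℕ.+ N ℕ.+ suc k) (ℕ.+-suc i i))) ⟩
      recip (N ℕ.+ N ℕ.+ suc (suc (i ℕ.+ i))) ℚ.+ recip (N ℕ.+ N ℕ.+ suc (suc (i ℕ.+ i)))
        ≤⟨ ℚ.+-monoˡ-≤ (recip (N ℕ.+ N ℕ.+ suc (suc (i ℕ.+ i))))
             (recip-anti {{nonZero-+ (N ℕ.+ N) (suc (i ℕ.+ i)) {{nonZero-+ N N}}}}
               (ℕ.+-monoʳ-≤ (N ℕ.+ N) (ℕ.n≤1+n (suc (i ℕ.+ i))))) ⟩
      recip (N ℕ.+ N ℕ.+ suc (i ℕ.+ i)) ℚ.+ recip (N ℕ.+ N ℕ.+ suc (suc (i ℕ.+ i))) ∎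

  2* : ∀ k → 2 ℕ.* k ≡ k ℕ.+ k
  2* k = cong (k ℕ.+_) (ℕ.+-identityʳ k)

  cells : ℕ → ℕ → ℕ
  cells m k = (m ℕ.∸ 1) ℕ.* 2 ℕ.^ k

  cells-suc : ∀ m k → cells m (suc k) ≡ cells m k ℕ.+ cells m k
  cells-suc m k = trans (cong ((m ℕ.∸ 1) ℕ.*_) (2* (2 ℕ.^ k)))
                        (ℕ.*-distribˡ-+ (m ℕ.∸ 1) (2 ℕ.^ k) (2 ℕ.^ k))

  upper lower : ℕ → ℕ → ℚ
  upper m k = riemannSum m (2 ℕ.^ k)
  lower m k = lowerSum (cells m k) (2 ℕ.^ k)

  upper-suc : ∀ m k → upper m (suc k) ℚ.≤ upper m k
  upper-suc m k = subst₂ (λ a b → upperSum a b ℚ.≤ upper m k)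
    (sym (cells-suc m k)) (sym (2* (2 ℕ.^ k)))
    (upper-step (cells m k) (2 ℕ.^ k) {{ℕ.m^n≢0 2 k}})

  lower-suc : ∀ m k → lower m k ℚ.≤ lower m (suc k)
  lower-suc m k = subst₂ (λ a b → lower m k ℚ.≤ lowerSum a b)
    (sym (cells-suc m k)) (sym (2* (2 ℕ.^ k)))
    (lower-step (cells m k) (2 ℕ.^ k) {{ℕ.m^n≢0 2 k}})

  antitone : ∀ (f : ℕ → ℚ) → (∀ k → f (suc k) ℚ.≤ f k) → ∀ {i j} → i ℕ.≤ j → f j ℚ.≤ f i
  antitone f step i≤j = go (ℕ.≤⇒≤′ i≤j)
    where
    go : ∀ {i j} → i ℕ.≤′ j → f j ℚ.≤ f i
    go (ℕ.≤′-reflexive refl) = ℚ.≤-refl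
    go (ℕ.≤′-step i≤j)       = ℚ.≤-trans (step _) (go i≤j)

  monotone : ∀ (f : ℕ → ℚ) → (∀ k → f k ℚ.≤ f (suc k)) → ∀ {i j} → i ℕ.≤ j → f i ℚ.≤ f j
  monotone f step i≤j = go (ℕ.≤⇒≤′ i≤j)
    where
    go : ∀ {i j} → i ℕ.≤′ j → f i ℚ.≤ f j
    go (ℕ.≤′-reflexive refl) = ℚ.≤-refl
    go (ℕ.≤′-step i≤j)       = ℚ.≤-trans (go i≤j) (step _)

  lower≤upper : ∀ m k → lower m k ℚ.≤ upper m k
  lower≤upper m k = ∑<-mono (cells m k) λ i →
    recip-anti {{nonZero-+ (2 ℕ.^ k) i {{ℕ.m^n≢0 2 k}}}} (ℕ.+-monoʳ-≤ (2 ℕ.^ k) (ℕ.n≤1+n i))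

  upper≤lower+ : ∀ m k → upper m k ℚ.≤ lower m k ℚ.+ recip (2 ℕ.^ k)
  upper≤lower+ m k = begin
    upper m k                                              ≡⟨ ℚ.+-identityʳ (upper m k) ⟨
    upper m k ℚ.+ 0ℚ                                       ≤⟨ ℚ.+-monoʳ-≤ (upper m k) (recip-nonNeg (2 ℕ.^ k ℕ.+ cells m k)) ⟩
    upper m k ℚ.+ recip (2 ℕ.^ k ℕ.+ cells m k)            ≡⟨ telescope (cells m k) (2 ℕ.^ k) ⟩
    lower m k ℚ.+ recip (2 ℕ.^ k)                          ∎
    where open ℚ.≤-Reasoning

  n≤2^n : ∀ n → n ℕ.≤ 2 ℕ.^ n
  n≤2^n zero    = ℕ.z≤n
  n≤2^n (suc n) = subst (suc n ℕ.≤_) (sym (2* (2 ℕ.^ n)))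
    (ℕ.+-mono-≤ (ℕ.m^n>0 2 n) (n≤2^n n))

  recip-small : ∀ ε → 0ℚ ℚ.< ε → ∃ λ N → recip (2 ℕ.^ N) ℚ.≤ ε
  recip-small (mkℚ (ℤ.+ zero) d _)  0<ε = contradiction (ℚ.positive 0<ε) λ ()
  recip-small (mkℚ (ℤ.-[1+ _ ]) d _) 0<ε = contradiction (ℚ.positive 0<ε) λ ()
  recip-small (mkℚ (ℤ.+ suc p) d c) 0<ε = suc d , ℚ.≤-trans (recip-anti (n≤2^n (suc d)))
    (subst (ℚ._≤ mkℚ (ℤ.+ suc p) d c) (sym (recip-suc d))
      (*≤* (ℤ.*-monoʳ-≤-nonNeg (ℤ.+ suc d) (ℤ.+≤+ (ℕ.s≤s (ℕ.z≤n {p}))))))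

  ∣-∣-≤ : ∀ {p q ε} → p ℚ.≤ q ℚ.+ ε → q ℚ.≤ p ℚ.+ ε → ℚ.∣ p ℚ.- q ∣ ℚ.≤ ε
  ∣-∣-≤ {p} {q} {ε} p≤q+ε q≤p+ε with ℚ.∣p∣≡p∨∣p∣≡-p (p ℚ.- q)
  ... | inj₁ eq = subst₂ ℚ._≤_ (sym eq) (solve 2 (λ q e → q :+ e :- q := e) refl q ε)
                    (ℚ.+-monoˡ-≤ (ℚ.- q) p≤q+ε)
    where open +-*-Solver
  ... | inj₂ eq = subst₂ ℚ._≤_
                    (trans (solve 2 (λ p q → q :- p := :- (p :- q)) refl p q) (sym eq))
                    (solve 2 (λ p e → p :+ e :- p := e) refl p ε)
                    (ℚ.+-monoˡ-≤ (ℚ.- p) q≤p+ε)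
    where open +-*-Solver

  upper-cauchy : ∀ m → IsCauchy (upper m)
  upper-cauchy m ε 0<ε with recip-small ε 0<ε
  ... | N , small = N , λ i j i≥ j≥ → ∣-∣-≤ (close i j i≥ j≥) (close j i j≥ i≥)
    where
    open ℚ.≤-Reasoning
    close : ∀ i j → N ℕ.≤ i → N ℕ.≤ j → upper m i ℚ.≤ upper m j ℚ.+ ε
    close i j i≥ j≥ = begin
      upper m i                         ≤⟨ antitone (upper m) (upper-suc m) i≥ ⟩
      upper m N                         ≤⟨ upper≤lower+ m N ⟩
      lower m N ℚ.+ recip (2 ℕ.^ N)     ≤⟨ ℚ.+-mono-≤ (monotone (lower m) (lower-suc m) j≥) small ⟩
      lower m j ℚ.+ ε                   ≤⟨ ℚ.+-monoˡ-≤ ε (lower≤upper m j) ⟩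
      upper m j ℚ.+ ε                   ∎

-- ln m = ∫₁ᵐ dt/t, the limit of the Riemann sums over partitions into intervals
-- of length 2⁻ᵏ.
ln : (m : ℕ) .{{_ : NonZero m}} → ℝ
ln m = mkℝ (λ k → riemannSum m (2 ℕ.^ k)) (RiemannSums.upper-cauchy m)

{-# OPTIONS --safe #-}

-- Let D be a dominating set (a total dominating set for the second bound) and M a
-- maximum matching.  The edges of M that avoid D are at least β₁ − |D| in number, so
-- the complement X of their union has at most n − 2β₁ + 2|D| vertices.  It contains D,
-- and every vertex outside X is matched to a vertex outside X.  Hence X is restrained
-- dominating (total restrained dominating) and it suffices that |D| ≤ (n/d)(1 + ln d),
-- where d = δ + 1 (d = δ) bounds the closed (open) neighbourhoods from below.
--
-- The greedy algorithm gives such a D: when u vertices are not dominated, some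
-- neighbourhood contains at least max(1, ud/n) of them, so the number of steps is at
-- most the sum of min(1, n/(dj)) over 1 ≤ j ≤ n.  This is n/d times a lower Riemann
-- sum of ∫₀ᵈ min(1, 1/t) dt = 1 + ln d.
module Submission where

open import Defs
open RiemannSums using (recip-nonNeg; recip-anti; ∑<-mono)
open import Data.Bool using (false; true; if_then_else_; _∧_; _∨_)
open import Data.Fin using (Fin; zero; suc)
open import Data.Fin.Properties using (suc-injective) renaming (_≟_ to _≟ᶠ_)
open import Data.Fin.Subset
  using (Subset; _∈_; _∉_; _⊆_; ∣_∣; _∩_; _∪_; _─_; ⁅_⁆; ⊥; ⊤; inside; outside)
open import Data.Fin.Subset.Properties
import Data.Integer as ℤ
import Data.Integer.Properties as ℤ
open import Data.Nat as ℕ using (ℕ; zero; suc; NonZero; _⊔_)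
open import Data.Nat.Induction using (<-wellFounded)
import Data.Nat.Properties as ℕ
open import Data.Product using (∃; _×_; _,_; proj₁; proj₂)
open import Data.Rational as ℚ using (ℚ; 0ℚ; 1ℚ)
import Data.Rational.Properties as ℚ
open import Data.Rational.Solver using (module +-*-Solver)
import Data.Rational.Unnormalised as ℚᵘ
import Data.Rational.Unnormalised.Properties as ℚᵘ
open import Data.Sum using (inj₁; inj₂)
open import Data.Vec using (Vec; []; _∷_; lookup; here; there)
open import Data.Vec.Properties using (lookup∘tabulate; []=⇒lookup; lookup-zipWith; lookup-replicate)
open import Function using (_∘_; mk⇔)
open import Induction.WellFounded using (Acc; acc)
open import Relation.Binary.PropositionalEquality
open import Relation.Nullary using (yes; no; does; contradiction)
open import Relation.Nullary.Decidable using (does-⇔)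

module Subsets where
  open import Algebra.Properties.Semiring.Sum ℕ.+-*-semiring
    using (sum; ∑-comm; *-distribˡ-sum; *-distribʳ-sum; sum-cong-≗)
  open import Data.Fin.Subset using (_-_)
  open import Data.Nat using (_+_; _*_; _≤_; z≤n; s≤s)
  open import Data.Nat.Properties hiding (_≟_; suc-injective)

  -- Cardinalities of finite subsets.

  x∈q⇒x∉p─q : ∀ {n} (p q : Subset n) {x} → x ∈ q → x ∉ p ─ q
  x∈q⇒x∉p─q (_ ∷ p) (_ ∷ q) here        ()
  x∈q⇒x∉p─q (_ ∷ p) (_ ∷ q) (there x∈q) (there x∈p─q) = x∈q⇒x∉p─q p q x∈q x∈p─q

  ∣p∩q∣+∣p─q∣≡∣p∣ : ∀ {n} (p q : Subset n) → ∣ p ∩ q ∣ + ∣ p ─ q ∣ ≡ ∣ p ∣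
  ∣p∩q∣+∣p─q∣≡∣p∣ []            []            = refl
  ∣p∩q∣+∣p─q∣≡∣p∣ (outside ∷ p) (outside ∷ q) = ∣p∩q∣+∣p─q∣≡∣p∣ p q
  ∣p∩q∣+∣p─q∣≡∣p∣ (outside ∷ p) (inside  ∷ q) = ∣p∩q∣+∣p─q∣≡∣p∣ p q
  ∣p∩q∣+∣p─q∣≡∣p∣ (inside  ∷ p) (outside ∷ q) =
    trans (+-suc ∣ p ∩ q ∣ ∣ p ─ q ∣) (cong suc (∣p∩q∣+∣p─q∣≡∣p∣ p q))
  ∣p∩q∣+∣p─q∣≡∣p∣ (inside  ∷ p) (inside  ∷ q) = cong suc (∣p∩q∣+∣p─q∣≡∣p∣ p q)

  ∣p∪⁅x⁆∣≤1+∣p∣ : ∀ {n} (p : Subset n) x → ∣ p ∪ ⁅ x ⁆ ∣ ≤ suc ∣ p ∣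
  ∣p∪⁅x⁆∣≤1+∣p∣ (outside ∷ p) zero    = ≤-reflexive (cong (suc ∘ ∣_∣) (∪-identityʳ p))
  ∣p∪⁅x⁆∣≤1+∣p∣ (inside  ∷ p) zero    =
    ≤-trans (≤-reflexive (cong (suc ∘ ∣_∣) (∪-identityʳ p))) (n≤1+n _)
  ∣p∪⁅x⁆∣≤1+∣p∣ (outside ∷ p) (suc x) = ∣p∪⁅x⁆∣≤1+∣p∣ p x
  ∣p∪⁅x⁆∣≤1+∣p∣ (inside  ∷ p) (suc x) = s≤s (∣p∪⁅x⁆∣≤1+∣p∣ p x)

  x∉p⇒1+∣p∣≤∣p∪⁅x⁆∣ : ∀ {n} {p : Subset n} {x} → x ∉ p → suc ∣ p ∣ ≤ ∣ p ∪ ⁅ x ⁆ ∣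
  x∉p⇒1+∣p∣≤∣p∪⁅x⁆∣ {p = p} {x} x∉p =
    p⊂q⇒∣p∣<∣q∣ (p⊆p∪q ⁅ x ⁆ , x , q⊆p∪q p ⁅ x ⁆ (x∈⁅x⁆ x) , x∉p)

  ⁅⁆-sym : ∀ {n} (v w : Fin n) → lookup ⁅ v ⁆ w ≡ lookup ⁅ w ⁆ v
  ⁅⁆-sym zero    zero    = refl
  ⁅⁆-sym zero    (suc w) = lookup-replicate w false
  ⁅⁆-sym (suc v) zero    = sym (lookup-replicate v false)
  ⁅⁆-sym (suc v) (suc w) = ⁅⁆-sym v w

  -- Restrained supersets obtained from a matching.

  module _ {n : ℕ} (G : Graph n) where
    open Graph G

    Uncovered : ∀ {k} → Vec (Fin n × Fin n) k → Fin n → Set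
    Uncovered M w = ∀ i → w ≢ proj₁ (lookup M i) × w ≢ proj₂ (lookup M i)

    -- The clause on `Uncovered` vertices carries the induction on `M`: the ends of an edge not yet
    -- treated are known to lie in `X`, so they can still be deleted from it.
    RestrainedSuperset : ∀ {k} → Vec (Fin n × Fin n) k → Subset n → Set
    RestrainedSuperset {k} M D =
      ∃ λ X → D ⊆ X
            × (∀ w → Uncovered M w → w ∈ X)
            × (∀ w → w ∉ X → ∃ λ u → u ∉ X × w ~ u)
            × 2 * k + ∣ X ∣ ≤ n + 2 * ∣ D ∣

    -- Induction on the matching. An edge that meets `D` is paid for by one of its ends, which is
    -- dropped from `D` in the recursive call; since matching edges are disjoint, no vertex pays
    -- twice. An edge that avoids `D` has both ends deleted from `X`, and these become each other's
    -- partners.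
    restrained-⊇ : ∀ {k} (M : Vec (Fin n × Fin n) k) → IsMatching G M → ∀ D → RestrainedSuperset M D
    restrained-⊇ [] _ D =
      ⊤ , (λ _ → ∈⊤) , (λ _ _ → ∈⊤) , (λ _ w∉⊤ → contradiction ∈⊤ w∉⊤) ,
      ≤-trans (≤-reflexive (∣⊤∣≡n n)) (m≤m+n n (2 * ∣ D ∣))
    restrained-⊇ {suc k} ((a , b) ∷ M) (edges , apart) D = cases
      where
      a~b : a ~ b
      a~b = edges zero

      matching : IsMatching G M
      matching = edges ∘ suc , λ i j i≢j → apart (suc i) (suc j) (i≢j ∘ suc-injective)

      a-uncovered : Uncovered M a
      a-uncovered i = proj₁ (apart zero (suc i) λ ())

      b-uncovered : Uncovered M b
      b-uncovered i = proj₂ (apart zero (suc i) λ ())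

      shift : ∀ m → 2 * suc k + m ≡ suc (suc (2 * k + m))
      shift m = cong (λ t → t + m) (*-suc 2 k)

      hit : ∀ {x} → x ∈ D → Uncovered M x → RestrainedSuperset ((a , b) ∷ M) D
      hit {x} x∈D x-uncovered with restrained-⊇ M matching (D - x)
      ... | X , D-x⊆X , uncovered⊆X , partner , size =
        X , D⊆X , (λ w w-unc → uncovered⊆X w (w-unc ∘ suc)) , partner , size′
        where
        D⊆X : D ⊆ X
        D⊆X {w} w∈D with w ≟ᶠ x
        -- The vertex dropped from `D` is still in `X`, because no remaining edge covers it.
        ... | yes refl = uncovered⊆X x x-uncovered
        ... | no  w≢x  = D-x⊆X (x∈p∧x≢y⇒x∈p-y w∈D w≢x)

        open ≤-Reasoning
        size′ : 2 * suc k + ∣ X ∣ ≤ n + 2 * ∣ D ∣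
        size′ = begin
          2 * suc k + ∣ X ∣                ≡⟨ shift ∣ X ∣ ⟩
          2 + (2 * k + ∣ X ∣)              ≤⟨ +-monoʳ-≤ 2 size ⟩
          2 + (n + 2 * ∣ D - x ∣)          ≡⟨ trans (cong (2 +_) (+-comm n _)) (+-comm (2 + 2 * ∣ D - x ∣) n) ⟩
          n + (2 + 2 * ∣ D - x ∣)          ≡⟨ cong (n +_) (*-suc 2 ∣ D - x ∣) ⟨
          n + 2 * suc ∣ D - x ∣            ≤⟨ +-monoʳ-≤ n (*-monoʳ-≤ 2 (x∈p⇒∣p-x∣<∣p∣ x∈D)) ⟩
          n + 2 * ∣ D ∣                    ∎

      avoid : a ∉ D → b ∉ D → RestrainedSuperset ((a , b) ∷ M) D
      avoid a∉D b∉D with restrained-⊇ M matching D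
      ... | X , D⊆X , uncovered⊆X , partner , size =
        Y , D⊆Y , uncovered⊆Y , partner′ , size′
        where
        Y : Subset n
        Y = X - a - b

        keep : ∀ {w} → w ∈ X → w ≢ a → w ≢ b → w ∈ Y
        keep w∈X w≢a w≢b = x∈p∧x≢y⇒x∈p-y (x∈p∧x≢y⇒x∈p-y w∈X w≢a) w≢b

        D⊆Y : D ⊆ Y
        D⊆Y w∈D = keep (D⊆X w∈D) (λ { refl → a∉D w∈D }) (λ { refl → b∉D w∈D })

        uncovered⊆Y : ∀ w → Uncovered ((a , b) ∷ M) w → w ∈ Y
        uncovered⊆Y w unc =
          keep (uncovered⊆X w (unc ∘ suc)) (proj₁ (unc zero)) (proj₂ (unc zero))

        Y⊆X : Y ⊆ X
        Y⊆X = p─q⊆p X ⁅ a ⁆ ∘ p─q⊆p (X - a) ⁅ b ⁆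

        b∉Y : b ∉ Y
        b∉Y = x∈q⇒x∉p─q (X - a) ⁅ b ⁆ (x∈⁅x⁆ b)

        a∉Y : a ∉ Y
        a∉Y = x∈q⇒x∉p─q X ⁅ a ⁆ (x∈⁅x⁆ a) ∘ p─q⊆p (X - a) ⁅ b ⁆

        partner′ : ∀ w → w ∉ Y → ∃ λ u → u ∉ Y × w ~ u
        partner′ w w∉Y with w ≟ᶠ a | w ≟ᶠ b | w ∈? X
        ... | yes refl | _        | _       = b , b∉Y , a~b
        ... | no _     | yes refl | _       = a , a∉Y , ~-sym a~b
        ... | no w≢a   | no w≢b   | yes w∈X = contradiction (keep w∈X w≢a w≢b) w∉Y
        ... | no _     | no _     | no w∉X with partner w w∉X
        ...   | u , u∉X , w~u = u , u∉X ∘ Y⊆X , w~u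

        -- Irreflexivity gives `a ≢ b`, so deleting `a` and then `b` really lowers the cardinality
        -- twice.
        b∈X-a : b ∈ X - a
        b∈X-a = x∈p∧x≢y⇒x∈p-y (uncovered⊆X b b-uncovered) λ { refl → ~-irrefl a~b }

        open ≤-Reasoning
        size′ : 2 * suc k + ∣ Y ∣ ≤ n + 2 * ∣ D ∣
        size′ = begin
          2 * suc k + ∣ Y ∣          ≡⟨ shift ∣ Y ∣ ⟩
          suc (suc (2 * k + ∣ Y ∣))  ≡⟨ cong suc (+-suc (2 * k) ∣ Y ∣) ⟨
          suc (2 * k + suc ∣ Y ∣)    ≡⟨ +-suc (2 * k) (suc ∣ Y ∣) ⟨
          2 * k + suc (suc ∣ Y ∣)    ≤⟨ +-monoʳ-≤ (2 * k) (s≤s (x∈p⇒∣p-x∣<∣p∣ b∈X-a)) ⟩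
          2 * k + suc ∣ X - a ∣      ≤⟨ +-monoʳ-≤ (2 * k) (x∈p⇒∣p-x∣<∣p∣ (uncovered⊆X a a-uncovered)) ⟩
          2 * k + ∣ X ∣              ≤⟨ size ⟩
          n + 2 * ∣ D ∣              ∎

      cases : RestrainedSuperset ((a , b) ∷ M) D
      cases with a ∈? D | b ∈? D
      ... | yes a∈D | _       = hit a∈D a-uncovered
      ... | no _    | yes b∈D = hit b∈D b-uncovered
      ... | no a∉D  | no b∉D  = avoid a∉D b∉D

  -- Double counting and averaging over neighbourhoods.

  indicator : ∀ {n} → Subset n → Fin n → ℕ
  indicator p x = if lookup p x then 1 else 0

  ∣p∣≡∑indicator : ∀ {n} (p : Subset n) → ∣ p ∣ ≡ sum (indicator p)
  ∣p∣≡∑indicator []            = refl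
  ∣p∣≡∑indicator (outside ∷ p) = ∣p∣≡∑indicator p
  ∣p∣≡∑indicator (inside  ∷ p) = cong suc (∣p∣≡∑indicator p)

  indicator-∩ : ∀ {n} (p q : Subset n) x → indicator (p ∩ q) x ≡ indicator p x * indicator q x
  indicator-∩ p q x = trans (cong (if_then 1 else 0) (lookup-zipWith _∧_ x p q)) (cases (lookup p x) (lookup q x))
    where
    cases : ∀ s t → (if s ∧ t then 1 else 0) ≡ (if s then 1 else 0) * (if t then 1 else 0)
    cases false _     = refl
    cases true  false = refl
    cases true  true  = refl

  sum-mono : ∀ {n} {f g : Fin n → ℕ} → (∀ i → f i ≤ g i) → sum f ≤ sum g
  sum-mono {zero}  f≤g = z≤n
  sum-mono {suc n} f≤g = +-mono-≤ (f≤g zero) (sum-mono (f≤g ∘ suc))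

  sum≤n*max : ∀ {n} .{{_ : NonZero n}} (f : Fin n → ℕ) → ∃ λ i → sum f ≤ n * f i
  sum≤n*max {suc zero}    f = zero , ≤-refl
  sum≤n*max {suc (suc n)} f with sum≤n*max (f ∘ suc)
  ... | i , le with ≤-total (f zero) (f (suc i))
  ...   | inj₁ f0≤fi = suc i , +-mono-≤ f0≤fi le
  ...   | inj₂ fi≤f0 = zero , +-monoʳ-≤ (f zero) (≤-trans le (*-monoʳ-≤ (suc n) fi≤f0))

  module _ {n d : ℕ} .{{_ : NonZero n}} (N : Fin n → Subset n)
           (N-sym : ∀ v w → lookup (N v) w ≡ lookup (N w) v) (d≤∣N∣ : ∀ v → d ≤ ∣ N v ∣) where

    -- Double counting of the pairs `(v , w)` with `v` in `U ∩ N w`. Symmetry is assumed as an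
    -- equality of Booleans so that it rewrites the indicators directly.
    ∑∣U∩N∣ : ∀ U → sum (λ w → ∣ U ∩ N w ∣) ≡ sum (λ v → indicator U v * ∣ N v ∣)
    ∑∣U∩N∣ U = begin
      sum (λ w → ∣ U ∩ N w ∣)
        ≡⟨ sum-cong-≗ (λ w → trans (∣p∣≡∑indicator (U ∩ N w)) (sum-cong-≗ (indicator-∩ U (N w)))) ⟩
      sum (λ w → sum (λ v → indicator U v * indicator (N w) v))
        ≡⟨ ∑-comm (λ w v → indicator U v * indicator (N w) v) ⟩
      sum (λ v → sum (λ w → indicator U v * indicator (N w) v))
        ≡⟨ sum-cong-≗ (λ v → sum-cong-≗ λ w → cong (λ s → indicator U v * (if s then 1 else 0)) (N-sym w v)) ⟩
      sum (λ v → sum (λ w → indicator U v * indicator (N v) w))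
        ≡⟨ sum-cong-≗ (λ v → sym (*-distribˡ-sum (indicator U v) (indicator (N v)))) ⟩
      sum (λ v → indicator U v * sum (indicator (N v)))
        ≡⟨ sum-cong-≗ (λ v → cong (indicator U v *_) (sym (∣p∣≡∑indicator (N v)))) ⟩
      sum (λ v → indicator U v * ∣ N v ∣) ∎
      where open ≡-Reasoning

    -- Averaging: the sizes of the `U ∩ N w` add up to at least `∣ U ∣ * d`, and some `w` reaches
    -- the mean.
    heavy-vertex : ∀ U → ∃ λ w → ∣ U ∣ * d ≤ n * ∣ U ∩ N w ∣
    heavy-vertex U with sum≤n*max (λ w → ∣ U ∩ N w ∣)
    ... | w , le = w , (begin
      ∣ U ∣ * d                            ≡⟨ cong (_* d) (∣p∣≡∑indicator U) ⟩
      sum (indicator U) * d                ≡⟨ *-distribʳ-sum d (indicator U) ⟩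
      sum (λ v → indicator U v * d)        ≤⟨ sum-mono (λ v → *-monoʳ-≤ (indicator U v) (d≤∣N∣ v)) ⟩
      sum (λ v → indicator U v * ∣ N v ∣)  ≡⟨ ∑∣U∩N∣ U ⟨
      sum (λ w → ∣ U ∩ N w ∣)              ≤⟨ le ⟩
      n * ∣ U ∩ N w ∣                      ∎)
      where open ≤-Reasoning

open Subsets
open import Data.Rational using (_+_; _*_; _-_; _≤_)

-- Natural numbers and their reciprocals as rationals.

ι : ℕ → ℚ
ι k = ℤ.+ k ℚ./ 1

-- The unnormalised form has an explicit numerator and denominator, so laws of `ι` become integer
-- identities. The argument `0` of `mkℚᵘ` is the denominator minus one.
toℚᵘ-ι : ∀ k → ℚ.toℚᵘ (ι k) ℚᵘ.≃ ℚᵘ.mkℚᵘ (ℤ.+ k) 0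
toℚᵘ-ι k = ℚ.toℚᵘ-fromℚᵘ (ℚᵘ.mkℚᵘ (ℤ.+ k) 0)

ι-+ : ∀ a b → ι (a ℕ.+ b) ≡ ι a + ι b
ι-+ a b = ℚ.toℚᵘ-injective (begin
  ℚ.toℚᵘ (ι (a ℕ.+ b))               ≈⟨ toℚᵘ-ι (a ℕ.+ b) ⟩
  ℚᵘ.mkℚᵘ (ℤ.+ (a ℕ.+ b)) 0          ≈⟨ ℚᵘ.*≡* (cong (ℤ._* ℤ.+ 1) numerator) ⟩
  ℚᵘ.mkℚᵘ (ℤ.+ a) 0 ℚᵘ.+ ℚᵘ.mkℚᵘ (ℤ.+ b) 0  ≈⟨ ℚᵘ.+-cong (toℚᵘ-ι a) (toℚᵘ-ι b) ⟨
  ℚ.toℚᵘ (ι a) ℚᵘ.+ ℚ.toℚᵘ (ι b)     ≈⟨ ℚ.toℚᵘ-homo-+ (ι a) (ι b) ⟨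
  ℚ.toℚᵘ (ι a + ι b)                 ∎)
  where
  open ℚᵘ.≃-Reasoning

  numerator : ℤ.+ (a ℕ.+ b) ≡ ℤ.+ a ℤ.* ℤ.+ 1 ℤ.+ ℤ.+ b ℤ.* ℤ.+ 1
  numerator = trans (ℤ.pos-+ a b)
    (sym (cong₂ ℤ._+_ (ℤ.*-identityʳ (ℤ.+ a)) (ℤ.*-identityʳ (ℤ.+ b))))

ι-* : ∀ a b → ι (a ℕ.* b) ≡ ι a * ι b
ι-* a b = ℚ.toℚᵘ-injective (begin
  ℚ.toℚᵘ (ι (a ℕ.* b))               ≈⟨ toℚᵘ-ι (a ℕ.* b) ⟩
  ℚᵘ.mkℚᵘ (ℤ.+ (a ℕ.* b)) 0          ≈⟨ ℚᵘ.*≡* (cong (ℤ._* ℤ.+ 1) (ℤ.pos-* a b)) ⟩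
  ℚᵘ.mkℚᵘ (ℤ.+ a) 0 ℚᵘ.* ℚᵘ.mkℚᵘ (ℤ.+ b) 0  ≈⟨ ℚᵘ.*-cong (toℚᵘ-ι a) (toℚᵘ-ι b) ⟨
  ℚ.toℚᵘ (ι a) ℚᵘ.* ℚ.toℚᵘ (ι b)     ≈⟨ ℚ.toℚᵘ-homo-* (ι a) (ι b) ⟨
  ℚ.toℚᵘ (ι a * ι b)                 ∎)
  where open ℚᵘ.≃-Reasoning

ι-mono : ∀ {a b} → a ℕ.≤ b → ι a ≤ ι b
ι-mono {a} {b} a≤b = ℚ.toℚᵘ-cancel-≤ (begin
  ℚ.toℚᵘ (ι a)          ≃⟨ toℚᵘ-ι a ⟩
  ℚᵘ.mkℚᵘ (ℤ.+ a) 0     ≤⟨ ℚᵘ.*≤* (ℤ.*-monoʳ-≤-nonNeg (ℤ.+ 1) (ℤ.+≤+ a≤b)) ⟩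
  ℚᵘ.mkℚᵘ (ℤ.+ b) 0     ≃⟨ toℚᵘ-ι b ⟨
  ℚ.toℚᵘ (ι b)          ∎)
  where open ℚᵘ.≤-Reasoning

ι-nonNeg : ∀ k → ℚ.NonNegative (ι k)
ι-nonNeg k = ℚ.nonNegative (ι-mono (ℕ.z≤n {k}))

ι-recip : ∀ k .{{_ : NonZero k}} → ι k * recip k ≡ 1ℚ
ι-recip (suc d) = ℚ.toℚᵘ-injective (begin
  ℚ.toℚᵘ (ι (suc d) * recip (suc d))            ≈⟨ ℚ.toℚᵘ-homo-* (ι (suc d)) (recip (suc d)) ⟩
  ℚ.toℚᵘ (ι (suc d)) ℚᵘ.* ℚ.toℚᵘ (recip (suc d)) ≈⟨ ℚᵘ.*-cong (toℚᵘ-ι (suc d)) (ℚ.toℚᵘ-fromℚᵘ (ℚᵘ.mkℚᵘ (ℤ.+ 1) d)) ⟩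
  ℚᵘ.mkℚᵘ (ℤ.+ suc d) 0 ℚᵘ.* ℚᵘ.mkℚᵘ (ℤ.+ 1) d  ≈⟨ ℚᵘ.*≡* cross ⟩
  ℚᵘ.1ℚᵘ                                        ∎)
  where
  open ℚᵘ.≃-Reasoning

  cross : (ℤ.+ suc d ℤ.* ℤ.+ 1) ℤ.* ℤ.+ 1 ≡ ℤ.+ 1 ℤ.* ℤ.+ suc (d ℕ.+ 0)
  cross = trans (ℤ.*-identityʳ (ℤ.+ suc d ℤ.* ℤ.+ 1)) (trans (ℤ.*-identityʳ (ℤ.+ suc d))
    (sym (trans (ℤ.*-identityˡ _) (cong (λ t → ℤ.+ suc t) (ℕ.+-identityʳ d)))))

recip-ι : ∀ k .{{_ : NonZero k}} → recip k * ι k ≡ 1ℚ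
recip-ι k = trans (ℚ.*-comm (recip k) (ι k)) (ι-recip k)

recip-* : ∀ a b .{{a≢0 : NonZero a}} .{{b≢0 : NonZero b}} → recip (a ℕ.* b) ≡ recip a * recip b
recip-* a b = begin
  recip (a ℕ.* b)
    ≡⟨ trans (cong (recip (a ℕ.* b) *_) (cong₂ _*_ (ι-recip a) (ι-recip b))) (ℚ.*-identityʳ _) ⟨
  recip (a ℕ.* b) * ((ι a * recip a) * (ι b * recip b))
    ≡⟨ solve 5 (λ r x p y q → r :* ((x :* p) :* (y :* q)) := (r :* (x :* y)) :* (p :* q)) refl
         (recip (a ℕ.* b)) (ι a) (recip a) (ι b) (recip b) ⟩
  (recip (a ℕ.* b) * (ι a * ι b)) * (recip a * recip b)
    ≡⟨ cong (λ t → (recip (a ℕ.* b) * t) * (recip a * recip b)) (ι-* a b) ⟨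
  (recip (a ℕ.* b) * ι (a ℕ.* b)) * (recip a * recip b)
    ≡⟨ cong (_* (recip a * recip b)) (recip-ι (a ℕ.* b) {{ℕ.m*n≢0 a b}}) ⟩
  1ℚ * (recip a * recip b)
    ≡⟨ ℚ.*-identityˡ _ ⟩
  recip a * recip b ∎
  where
  open ≡-Reasoning
  open +-*-Solver

-- Finite sums of rationals.

∑<-cong : ∀ n {f g : ℕ → ℚ} → (∀ i → f i ≡ g i) → ∑< n f ≡ ∑< n g
∑<-cong zero    f≗g = refl
∑<-cong (suc n) f≗g = cong₂ _+_ (∑<-cong n f≗g) (f≗g n)

∑<-++ : ∀ m n f → ∑< (m ℕ.+ n) f ≡ ∑< m f + ∑< n (λ i → f (m ℕ.+ i))
∑<-++ m zero    f = trans (cong (λ k → ∑< k f) (ℕ.+-identityʳ m)) (sym (ℚ.+-identityʳ (∑< m f)))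
∑<-++ m (suc n) f = begin
  ∑< (m ℕ.+ suc n) f                                              ≡⟨ cong (λ k → ∑< k f) (ℕ.+-suc m n) ⟩
  ∑< (m ℕ.+ n) f + f (m ℕ.+ n)                                    ≡⟨ cong (_+ f (m ℕ.+ n)) (∑<-++ m n f) ⟩
  ∑< m f + ∑< n (λ i → f (m ℕ.+ i)) + f (m ℕ.+ n)                 ≡⟨ ℚ.+-assoc (∑< m f) _ _ ⟩
  ∑< m f + ∑< (suc n) (λ i → f (m ℕ.+ i))                         ∎
  where open ≡-Reasoning

∑<-*ˡ : ∀ n c f → ∑< n (λ i → c * f i) ≡ c * ∑< n f
∑<-*ˡ zero    c f = sym (ℚ.*-zeroʳ c)
∑<-*ˡ (suc n) c f = trans (cong (_+ c * f n) (∑<-*ˡ n c f)) (sym (ℚ.*-distribˡ-+ c (∑< n f) (f n)))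

ι-suc-* : ∀ n c → ι n * c + c ≡ ι (suc n) * c
ι-suc-* n c = begin
  ι n * c + c        ≡⟨ cong (ι n * c +_) (ℚ.*-identityˡ c) ⟨
  ι n * c + ι 1 * c  ≡⟨ ℚ.*-distribʳ-+ c (ι n) (ι 1) ⟨
  (ι n + ι 1) * c    ≡⟨ cong (_* c) (ι-+ n 1) ⟨
  ι (n ℕ.+ 1) * c    ≡⟨ cong (λ k → ι k * c) (ℕ.+-comm n 1) ⟩
  ι (suc n) * c      ∎
  where open ≡-Reasoning

∑<-lower : ∀ n {c} f → (∀ i → i ℕ.< n → c ≤ f i) → ι n * c ≤ ∑< n f
∑<-lower zero    {c} f c≤f = ℚ.≤-reflexive (ℚ.*-zeroˡ c)
∑<-lower (suc n) {c} f c≤f = ℚ.≤-trans (ℚ.≤-reflexive (sym (ι-suc-* n c)))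
  (ℚ.+-mono-≤ (∑<-lower n f λ i i<n → c≤f i (ℕ.m<n⇒m<1+n i<n)) (c≤f n ℕ.≤-refl))

∑<-upper : ∀ n {c} f → (∀ i → i ℕ.< n → f i ≤ c) → ∑< n f ≤ ι n * c
∑<-upper zero    {c} f f≤c = ℚ.≤-reflexive (sym (ℚ.*-zeroˡ c))
∑<-upper (suc n) {c} f f≤c = ℚ.≤-trans
  (ℚ.+-mono-≤ (∑<-upper n f λ i i<n → f≤c i (ℕ.m<n⇒m<1+n i<n)) (f≤c n ℕ.≤-refl))
  (ℚ.≤-reflexive (ι-suc-* n c))

-- Comparison of sums with the integral of min(1, 1/t).

Antitone : (ℕ → ℚ) → Set
Antitone g = ∀ {i j} → i ℕ.≤ j → g j ≤ g i

-- In each block of `a` consecutive arguments the value at the last one is the smallest, so it may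
-- replace all the others from below.
coarse-lower : ∀ a b {g} → Antitone g →
  ι a * ∑< b (λ j → g (suc j ℕ.* a)) ≤ ∑< (b ℕ.* a) (λ i → g (suc i))
coarse-lower a zero    {g} anti = ℚ.≤-reflexive (ℚ.*-zeroʳ (ι a))
coarse-lower a (suc b) {g} anti = begin
  ι a * (∑< b (λ j → g (suc j ℕ.* a)) + g (suc b ℕ.* a))
    ≡⟨ ℚ.*-distribˡ-+ (ι a) _ _ ⟩
  ι a * ∑< b (λ j → g (suc j ℕ.* a)) + ι a * g (suc b ℕ.* a)
    ≤⟨ ℚ.+-mono-≤ (coarse-lower a b anti) (∑<-lower a (λ i → g (suc (b ℕ.* a ℕ.+ i))) block) ⟩
  ∑< (b ℕ.* a) (λ i → g (suc i)) + ∑< a (λ i → g (suc (b ℕ.* a ℕ.+ i)))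
    ≡⟨ ∑<-++ (b ℕ.* a) a (λ i → g (suc i)) ⟨
  ∑< (b ℕ.* a ℕ.+ a) (λ i → g (suc i))
    ≡⟨ cong (λ k → ∑< k (λ i → g (suc i))) (ℕ.+-comm (b ℕ.* a) a) ⟩
  ∑< (suc b ℕ.* a) (λ i → g (suc i)) ∎
  where
  open ℚ.≤-Reasoning
  block : ∀ i → i ℕ.< a → g (suc b ℕ.* a) ≤ g (suc (b ℕ.* a ℕ.+ i))
  block i i<a = anti (subst₂ ℕ._≤_ (ℕ.+-suc (b ℕ.* a) i) (ℕ.+-comm (b ℕ.* a) a) (ℕ.+-monoʳ-≤ (b ℕ.* a) i<a))

-- Dually, each block is bounded above by the value at its first argument.
coarse-upper : ∀ a b {g} → Antitone g →
  ∑< (b ℕ.* a) g ≤ ι a * ∑< b (λ j → g (j ℕ.* a))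
coarse-upper a zero    {g} anti = ℚ.≤-reflexive (sym (ℚ.*-zeroʳ (ι a)))
coarse-upper a (suc b) {g} anti = begin
  ∑< (suc b ℕ.* a) g
    ≡⟨ cong (λ k → ∑< k g) (ℕ.+-comm a (b ℕ.* a)) ⟩
  ∑< (b ℕ.* a ℕ.+ a) g
    ≡⟨ ∑<-++ (b ℕ.* a) a g ⟩
  ∑< (b ℕ.* a) g + ∑< a (λ i → g (b ℕ.* a ℕ.+ i))
    ≤⟨ ℚ.+-mono-≤ (coarse-upper a b anti) (∑<-upper a (λ i → g (b ℕ.* a ℕ.+ i)) λ i _ → anti (ℕ.m≤m+n (b ℕ.* a) i)) ⟩
  ι a * ∑< b (λ j → g (j ℕ.* a)) + ι a * g (b ℕ.* a)
    ≡⟨ ℚ.*-distribˡ-+ (ι a) _ _ ⟨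
  ι a * ∑< (suc b) (λ j → g (j ℕ.* a)) ∎
  where open ℚ.≤-Reasoning

m⊔n≢0 : ∀ m n .{{_ : NonZero m}} → NonZero (m ⊔ n)
m⊔n≢0 m n = ℕ.>-nonZero (ℕ.≤-trans (ℕ.>-nonZero⁻¹ m) (ℕ.m≤m⊔n m n))

cancel-ι : ∀ k s .{{_ : NonZero k}} → ι k * (recip k * s) ≡ s
cancel-ι k s = begin
  ι k * (recip k * s)   ≡⟨ ℚ.*-assoc (ι k) (recip k) s ⟨
  ι k * recip k * s     ≡⟨ cong (_* s) (ι-recip k) ⟩
  1ℚ * s                ≡⟨ ℚ.*-identityˡ s ⟩
  s                     ∎
  where open ≡-Reasoning

∑<-recip-* : ∀ c m f .{{_ : NonZero c}} → (∀ j → NonZero (f j)) →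
  ι c * ∑< m (λ j → recip (c ℕ.* f j)) ≡ ∑< m (λ j → recip (f j))
∑<-recip-* c m f f≢0 = begin
  ι c * ∑< m (λ j → recip (c ℕ.* f j))
    ≡⟨ cong (ι c *_) (∑<-cong m λ j → recip-* c (f j) {{b≢0 = f≢0 j}}) ⟩
  ι c * ∑< m (λ j → recip c * recip (f j))
    ≡⟨ cong (ι c *_) (∑<-*ˡ m (recip c) (recip ∘ f)) ⟩
  ι c * (recip c * ∑< m (λ j → recip (f j)))
    ≡⟨ cancel-ι c _ ⟩
  ∑< m (λ j → recip (f j)) ∎
  where open ≡-Reasoning

-- `recip (N ⊔ j)` is 1/N times min(1, 1/t) at t = j/N. The first `N` terms are at most 1/N each and
-- give `1ℚ`; the later ones are exactly the terms of `riemannSum d N`.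
∑<-recip-⊔-riemann : ∀ d N .{{_ : NonZero d}} .{{_ : NonZero N}} →
  ∑< (d ℕ.* N) (λ j → recip (N ⊔ j)) ≤ 1ℚ + riemannSum d N
∑<-recip-⊔-riemann (suc e) N = begin
  ∑< (N ℕ.+ e ℕ.* N) (λ j → recip (N ⊔ j))
    ≡⟨ ∑<-++ N (e ℕ.* N) _ ⟩
  ∑< N (λ j → recip (N ⊔ j)) + ∑< (e ℕ.* N) (λ j → recip (N ⊔ (N ℕ.+ j)))
    ≤⟨ ℚ.+-mono-≤ (∑<-upper N _ λ j _ → recip-anti (ℕ.m≤m⊔n N j))
                  (ℚ.≤-reflexive (∑<-cong (e ℕ.* N) λ j → cong recip (ℕ.m≤n⇒m⊔n≡n (ℕ.m≤m+n N j)))) ⟩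
  ι N * recip N + riemannSum (suc e) N
    ≡⟨ cong (_+ riemannSum (suc e) N) (ι-recip N) ⟩
  1ℚ + riemannSum (suc e) N ∎
  where open ℚ.≤-Reasoning

-- With f(t) = min(1, 1/t), a lower sum of ∫₀ᵈ f over n cells lies below an upper
-- sum over d N cells, since both compare with the refinement into n d N cells.
-- The cells of the upper sum inside [0, 1] contribute 1.
∑<-recip-⊔-ln : ∀ n d N .{{_ : NonZero n}} .{{_ : NonZero d}} .{{_ : NonZero N}} →
  ι d * ∑< n (λ j → recip (n ⊔ suc j ℕ.* d)) ≤ 1ℚ + riemannSum d N
∑<-recip-⊔-ln n d N = begin
  ι d * ∑< n (λ j → recip (n ⊔ suc j ℕ.* d))
    ≡⟨ cong (ι d *_) (∑<-recip-* N n (λ j → n ⊔ suc j ℕ.* d) (λ j → m⊔n≢0 n _)) ⟨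
  ι d * (ι N * ∑< n (λ j → recip (N ℕ.* (n ⊔ suc j ℕ.* d))))
    ≡⟨ trans (cong (_* ∑< n (λ j → recip (N ℕ.* (n ⊔ suc j ℕ.* d)))) (ι-* d N)) (ℚ.*-assoc (ι d) (ι N) _) ⟨
  ι (d ℕ.* N) * ∑< n (λ j → recip (N ℕ.* (n ⊔ suc j ℕ.* d)))
    ≡⟨ cong (ι (d ℕ.* N) *_) (∑<-cong n λ j → cong recip (rescale j)) ⟩
  ι (d ℕ.* N) * ∑< n (λ j → g (suc j ℕ.* (d ℕ.* N)))
    ≤⟨ coarse-lower (d ℕ.* N) n anti ⟩
  ∑< (n ℕ.* (d ℕ.* N)) (λ i → g (suc i))
    -- On the common refinement, right endpoints are exchanged for left endpoints.
    ≤⟨ ∑<-mono (n ℕ.* (d ℕ.* N)) (λ i → anti (ℕ.n≤1+n i)) ⟩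
  ∑< (n ℕ.* (d ℕ.* N)) g
    ≡⟨ cong (λ k → ∑< k g) (ℕ.*-comm n (d ℕ.* N)) ⟩
  ∑< (d ℕ.* N ℕ.* n) g
    ≤⟨ coarse-upper n (d ℕ.* N) anti ⟩
  ι n * ∑< (d ℕ.* N) (λ j → g (j ℕ.* n))
    ≡⟨ cong (ι n *_) (∑<-cong (d ℕ.* N) λ j → cong recip
         (trans (cong (n ℕ.* N ⊔_) (ℕ.*-comm j n)) (sym (ℕ.*-distribˡ-⊔ n N j)))) ⟩
  ι n * ∑< (d ℕ.* N) (λ j → recip (n ℕ.* (N ⊔ j)))
    ≡⟨ ∑<-recip-* n (d ℕ.* N) (N ⊔_) (λ j → m⊔n≢0 N j) ⟩
  ∑< (d ℕ.* N) (λ j → recip (N ⊔ j))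
    ≤⟨ ∑<-recip-⊔-riemann d N ⟩
  1ℚ + riemannSum d N ∎
  where
  open ℚ.≤-Reasoning

  -- The cell length 1/(nN) times min(1, 1/t) at t = i/(nN). Cells of length d/n end at multiples of
  -- `d ℕ.* N`, and cells of length 1/N begin at multiples of `n`.
  g : ℕ → ℚ
  g i = recip (n ℕ.* N ⊔ i)

  anti : Antitone g
  anti {i} i≤j = recip-anti {{m⊔n≢0 (n ℕ.* N) i {{ℕ.m*n≢0 n N}}}} (ℕ.⊔-mono-≤ (ℕ.≤-refl {n ℕ.* N}) i≤j)

  rescale : ∀ j → N ℕ.* (n ⊔ suc j ℕ.* d) ≡ n ℕ.* N ⊔ suc j ℕ.* (d ℕ.* N)
  rescale j = trans (ℕ.*-comm N _) (trans (ℕ.*-distribʳ-⊔ N n (suc j ℕ.* d))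
    (cong (n ℕ.* N ⊔_) (ℕ.*-assoc (suc j) d N)))

-- The greedy covering algorithm.

-- The sum of min(1, n/(dj)) over 1 ≤ j ≤ k, which bounds the number of greedy steps
-- needed while k vertices are not dominated.
greedyBound : (n d k : ℕ) → ℚ
greedyBound n d k = ι n * ∑< k (λ j → recip (n ⊔ suc j ℕ.* d))

-- The `c` added terms pay for one greedy step: each is at least 1/(nc), because `n` and (k + i +
-- 1)d, which is at most (k + c)d, are both at most nc.
greedyBound-step : ∀ n d k c .{{_ : NonZero n}} .{{_ : NonZero c}} →
  (k ℕ.+ c) ℕ.* d ℕ.≤ n ℕ.* c → greedyBound n d k + 1ℚ ≤ greedyBound n d (k ℕ.+ c)
greedyBound-step n d k c le = begin
  ι n * ∑< k f + 1ℚ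
    ≡⟨ cong (ι n * ∑< k f +_) (trans (sym (ι-recip (n ℕ.* c) {{ℕ.m*n≢0 n c}}))
         (trans (cong (_* recip (n ℕ.* c)) (ι-* n c)) (ℚ.*-assoc (ι n) (ι c) _))) ⟩
  ι n * ∑< k f + ι n * (ι c * recip (n ℕ.* c))
    ≤⟨ ℚ.+-monoʳ-≤ (ι n * ∑< k f) (ℚ.*-monoˡ-≤-nonNeg (ι n) {{ι-nonNeg n}} (∑<-lower c (λ i → f (k ℕ.+ i)) term)) ⟩
  ι n * ∑< k f + ι n * ∑< c (λ i → f (k ℕ.+ i))
    ≡⟨ ℚ.*-distribˡ-+ (ι n) _ _ ⟨
  ι n * (∑< k f + ∑< c (λ i → f (k ℕ.+ i)))
    ≡⟨ cong (ι n *_) (∑<-++ k c f) ⟨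
  ι n * ∑< (k ℕ.+ c) f ∎
  where
  open ℚ.≤-Reasoning

  f : ℕ → ℚ
  f j = recip (n ⊔ suc j ℕ.* d)

  term : ∀ i → i ℕ.< c → recip (n ℕ.* c) ≤ f (k ℕ.+ i)
  term i i<c = recip-anti {{m⊔n≢0 n _}} (ℕ.⊔-lub (ℕ.m≤m*n n c)
    (ℕ.≤-trans (ℕ.*-monoˡ-≤ d (ℕ.≤-trans (ℕ.≤-reflexive (sym (ℕ.+-suc k i))) (ℕ.+-monoʳ-≤ k i<c))) le))

-- For open neighbourhoods this is total domination by `D`; for closed ones it is domination.
Meets : ∀ {n} → (Fin n → Subset n) → Subset n → Set
Meets N D = ∀ v → ∃ λ w → w ∈ D × v ∈ N w

-- The bound is required for every mesh 1/K, so it applies to each term of the sequence defining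
-- `ln d` and no limit has to be taken.
Transversal : ∀ {n} → (Fin n → Subset n) → ℕ → Set
Transversal {n} N d = ∃ λ D → Meets N D
  × (∀ K .{{_ : NonZero K}} → ι d * ι ∣ D ∣ ≤ ι n * (1ℚ + riemannSum d K))

module _ {n d : ℕ} .{{_ : NonZero n}} .{{_ : NonZero d}} (N : Fin n → Subset n)
         (N-sym : ∀ v w → lookup (N v) w ≡ lookup (N w) v) (d≤∣N∣ : ∀ v → d ℕ.≤ ∣ N v ∣) where

  GreedyCover : Subset n → Set
  GreedyCover U =
    ∃ λ D → (∀ v → v ∈ U → ∃ λ w → w ∈ D × v ∈ N w) × ι ∣ D ∣ ≤ greedyBound n d ∣ U ∣

  greedyCover : ∀ U → Acc ℕ._<_ ∣ U ∣ → GreedyCover U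
  greedyCover U (acc rec) with nonempty? U
  ... | no empty = ⊥ , (λ v v∈U → contradiction (v , v∈U) empty) , (begin
    ι ∣ ⊥ {n} ∣              ≡⟨ cong ι (∣⊥∣≡0 n) ⟩
    ι 0                      ≡⟨ ℚ.*-zeroʳ (ι n) ⟨
    greedyBound n d 0        ≡⟨ cong (greedyBound n d) (trans (cong ∣_∣ (Empty-unique empty)) (∣⊥∣≡0 n)) ⟨
    greedyBound n d ∣ U ∣    ∎)
    where open ℚ.≤-Reasoning
  ... | yes (x , x∈U) with heavy-vertex N N-sym d≤∣N∣ U
  ...   | w , ud≤nc = extend (greedyCover (U ─ N w) (rec smaller))
    where
    c = ∣ U ∩ N w ∣

    instance
      u≢0 : NonZero ∣ U ∣
      u≢0 = ℕ.>-nonZero (ℕ.≤-trans (ℕ.s≤s ℕ.z≤n) (x∈p⇒∣p-x∣<∣p∣ x∈U))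

      -- As `∣ U ∣` and `d` are positive, `ud≤nc` forces `c` to be positive. This gives both the
      -- descent in `smaller` and the non-zero `c` of `greedyBound-step`.
      c≢0 : NonZero c
      c≢0 = ℕ.m*n≢0⇒n≢0 n
        {{ℕ.>-nonZero (ℕ.≤-trans (ℕ.>-nonZero⁻¹ (∣ U ∣ ℕ.* d) {{ℕ.m*n≢0 ∣ U ∣ d}}) ud≤nc)}}

    remaining : ∣ U ─ N w ∣ ℕ.+ c ≡ ∣ U ∣
    remaining = trans (ℕ.+-comm _ c) (∣p∩q∣+∣p─q∣≡∣p∣ U (N w))

    smaller : ∣ U ─ N w ∣ ℕ.< ∣ U ∣
    smaller = subst (∣ U ─ N w ∣ ℕ.<_) remaining (ℕ.m<m+n _ (ℕ.>-nonZero⁻¹ c))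

    extend : GreedyCover (U ─ N w) → GreedyCover U
    extend (D , hits , size) = D ∪ ⁅ w ⁆ , hits′ , size′
      where
      hits′ : ∀ v → v ∈ U → ∃ λ w′ → w′ ∈ D ∪ ⁅ w ⁆ × v ∈ N w′
      hits′ v v∈U with v ∈? N w
      ... | yes v∈Nw = w , q⊆p∪q D ⁅ w ⁆ (x∈⁅x⁆ w) , v∈Nw
      ... | no  v∉Nw with hits v (x∈p∧x∉q⇒x∈p─q v∈U v∉Nw)
      ...   | w′ , w′∈D , v∈Nw′ = w′ , p⊆p∪q ⁅ w ⁆ w′∈D , v∈Nw′

      open ℚ.≤-Reasoning
      size′ : ι ∣ D ∪ ⁅ w ⁆ ∣ ≤ greedyBound n d ∣ U ∣
      size′ = begin
        ι ∣ D ∪ ⁅ w ⁆ ∣                      ≤⟨ ι-mono (∣p∪⁅x⁆∣≤1+∣p∣ D w) ⟩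
        ι (suc ∣ D ∣)                        ≡⟨ cong ι (ℕ.+-comm 1 ∣ D ∣) ⟩
        ι (∣ D ∣ ℕ.+ 1)                      ≡⟨ ι-+ ∣ D ∣ 1 ⟩
        ι ∣ D ∣ + 1ℚ                         ≤⟨ ℚ.+-monoˡ-≤ 1ℚ size ⟩
        greedyBound n d ∣ U ─ N w ∣ + 1ℚ     ≤⟨ greedyBound-step n d ∣ U ─ N w ∣ c
                                                  (subst (λ u → u ℕ.* d ℕ.≤ n ℕ.* c) (sym remaining) ud≤nc) ⟩
        greedyBound n d (∣ U ─ N w ∣ ℕ.+ c)  ≡⟨ cong (greedyBound n d) remaining ⟩
        greedyBound n d ∣ U ∣                ∎

  transversal : Transversal N d
  transversal with greedyCover ⊤ (<-wellFounded _)
  ... | D , hits , size = D , (λ v → hits v ∈⊤) , bound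
    where
    open ℚ.≤-Reasoning
    open +-*-Solver
    swap : ∀ a b s → a * (b * s) ≡ b * (a * s)
    swap = solve 3 (λ a b s → a :* (b :* s) := b :* (a :* s)) refl

    bound : ∀ K .{{_ : NonZero K}} → ι d * ι ∣ D ∣ ≤ ι n * (1ℚ + riemannSum d K)
    bound K = begin
      ι d * ι ∣ D ∣                       ≤⟨ ℚ.*-monoˡ-≤-nonNeg (ι d) {{ι-nonNeg d}} size ⟩
      ι d * greedyBound n d ∣ ⊤ {n} ∣     ≡⟨ cong (λ k → ι d * greedyBound n d k) (∣⊤∣≡n n) ⟩
      ι d * greedyBound n d n             ≡⟨ swap (ι d) (ι n) _ ⟩
      ι n * (ι d * ∑< n (λ j → recip (n ⊔ suc j ℕ.* d)))
                                          ≤⟨ ℚ.*-monoˡ-≤-nonNeg (ι n) {{ι-nonNeg n}} (∑<-recip-⊔-ln n d K) ⟩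
      ι n * (1ℚ + riemannSum d K)         ∎

-- Passage to the real inequality.

1/-recip : ∀ d .{{_ : NonZero d}} → ℤ.+ 1 ℚ./ d ≡ recip d
1/-recip (suc d) = refl

-- With L for the logarithm, x is at most n + 2(n/d)(1 + L) - 2β, that is, (2L + d + 2)n/d - 2β.
-- Splitting d + 2 as `e + c` lets one lemma yield both numerators: δ + 3 for d = δ + 1 and δ + 2
-- for d = δ.
≤-ln-bound : ∀ n d e c {t x γ β} .{{_ : NonZero d}} → e ℕ.+ c ≡ d ℕ.+ 2 →
  (∀ N .{{_ : NonZero N}} → ι d * ι t ≤ ι n * (1ℚ + riemannSum d N)) →
  2 ℕ.* β ℕ.+ x ℕ.≤ n ℕ.+ 2 ℕ.* t → γ ℕ.≤ x →
  fromℕ γ ≤ᴿ (fromℕ 2 *ᴿ ln d +ᴿ fromℕ e +ᴿ fromℕ c) /ᴿ d *ᴿ fromℕ n -ᴿ fromℕ 2 *ᴿ fromℕ β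
≤-ln-bound n d e c {t} {x} {γ} {β} e+c≡d+2 dt≤ 2β+x≤n+2t γ≤x ε 0<ε =
  -- The inequality holds term by term even without `ε`, so the threshold is 0. The k-th term of
  -- `ln d` is the Riemann sum with mesh 1/2^k.
  0 , λ k _ → bound (riemannSum d (2 ℕ.^ k)) (dt≤ (2 ℕ.^ k) {{ℕ.m^n≢0 2 k}})
  where
  open ℚ.≤-Reasoning
  open +-*-Solver

  r : ℚ
  r = ℤ.+ 1 ℚ./ d

  rd≡1 : r * ι d ≡ 1ℚ
  rd≡1 = trans (cong (_* ι d) (1/-recip d)) (recip-ι d)

  instance
    r-nonNeg : ℚ.NonNegative r
    r-nonNeg = ℚ.nonNegative (subst (0ℚ ≤_) (sym (1/-recip d)) (recip-nonNeg d))

  t-bound : ∀ {y} → ι d * ι t ≤ y → ι t ≤ r * y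
  t-bound {y} dt≤y = begin
    ι t               ≡⟨ ℚ.*-identityˡ (ι t) ⟨
    1ℚ * ι t          ≡⟨ cong (_* ι t) rd≡1 ⟨
    r * ι d * ι t     ≡⟨ ℚ.*-assoc r (ι d) (ι t) ⟩
    r * (ι d * ι t)   ≤⟨ ℚ.*-monoˡ-≤-nonNeg r dt≤y ⟩
    r * y             ∎

  x-bound : ι x ≤ ι n + ι 2 * ι t - ι 2 * ι β
  x-bound = begin
    ι x                                 ≡⟨ solve 2 (λ x b → x := b :+ x :- b) refl (ι x) (ι 2 * ι β) ⟩
    ι 2 * ι β + ι x - ι 2 * ι β         ≡⟨ cong (λ s → s + ι x - ι 2 * ι β) (ι-* 2 β) ⟨
    ι (2 ℕ.* β) + ι x - ι 2 * ι β       ≡⟨ cong (_- ι 2 * ι β) (ι-+ (2 ℕ.* β) x) ⟨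
    ι (2 ℕ.* β ℕ.+ x) - ι 2 * ι β       ≤⟨ ℚ.+-monoˡ-≤ (ℚ.- (ι 2 * ι β)) (ι-mono 2β+x≤n+2t) ⟩
    ι (n ℕ.+ 2 ℕ.* t) - ι 2 * ι β       ≡⟨ cong (_- ι 2 * ι β) (ι-+ n (2 ℕ.* t)) ⟩
    ι n + ι (2 ℕ.* t) - ι 2 * ι β       ≡⟨ cong (λ s → ι n + s - ι 2 * ι β) (ι-* 2 t) ⟩
    ι n + ι 2 * ι t - ι 2 * ι β         ∎

  constants : ι e + ι c ≡ ι d + ι 2
  constants = trans (sym (ι-+ e c)) (trans (cong ι e+c≡d+2) (ι-+ d 2))

  bound : ∀ L → ι d * ι t ≤ ι n * (1ℚ + L) →
    ι γ ≤ (ι 2 * L + ι e + ι c) * r * ι n - ι 2 * ι β + ε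
  bound L dt≤nL = begin
    ι γ
      ≤⟨ ι-mono γ≤x ⟩
    ι x
      ≤⟨ x-bound ⟩
    ι n + ι 2 * ι t - ι 2 * ι β
      ≤⟨ ℚ.+-monoˡ-≤ (ℚ.- (ι 2 * ι β)) (ℚ.+-monoʳ-≤ (ι n)
           (ℚ.*-monoˡ-≤-nonNeg (ι 2) {{ι-nonNeg 2}} (t-bound dt≤nL))) ⟩
    ι n + ι 2 * (r * (ι n * (1ℚ + L))) - ι 2 * ι β
      -- Writing n as (1/d)dn brings everything except 2β under the factor n/d, where d + 2 appears.
      ≡⟨ cong (λ s → s + ι 2 * (r * (ι n * (1ℚ + L))) - ι 2 * ι β)
           (trans (sym (ℚ.*-identityˡ (ι n))) (cong (_* ι n) (sym rd≡1))) ⟩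
    r * ι d * ι n + ι 2 * (r * (ι n * (1ℚ + L))) - ι 2 * ι β
      ≡⟨ solve 6 (λ k r d n L b →
           r :* d :* n :+ k :* (r :* (n :* (con 1ℚ :+ L))) :- b
             := (k :* L :+ (d :+ k)) :* r :* n :- b)
           refl (ι 2) r (ι d) (ι n) L (ι 2 * ι β) ⟩
    (ι 2 * L + (ι d + ι 2)) * r * ι n - ι 2 * ι β
      ≡⟨ cong (λ s → (ι 2 * L + s) * r * ι n - ι 2 * ι β) constants ⟨
    (ι 2 * L + (ι e + ι c)) * r * ι n - ι 2 * ι β
      ≡⟨ cong (λ s → s * r * ι n - ι 2 * ι β) (ℚ.+-assoc (ι 2 * L) (ι e) (ι c)) ⟨
    (ι 2 * L + ι e + ι c) * r * ι n - ι 2 * ι β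
      ≡⟨ ℚ.+-identityʳ _ ⟨
    (ι 2 * L + ι e + ι c) * r * ι n - ι 2 * ι β + 0ℚ
      ≤⟨ ℚ.+-monoʳ-≤ ((ι 2 * L + ι e + ι c) * r * ι n - ι 2 * ι β) (ℚ.<⇒≤ 0<ε) ⟩
    (ι 2 * L + ι e + ι c) * r * ι n - ι 2 * ι β + ε ∎

-- Application to open and closed neighbourhoods.

module _ {n : ℕ} (G : Graph n) where
  open Graph G

  lookup-neighbours : ∀ v w → lookup (neighbours G v) w ≡ does (v ~? w)
  lookup-neighbours v = lookup∘tabulate (λ w → does (v ~? w))

  ∈-neighbours⁻ : ∀ {v w} → w ∈ neighbours G v → v ~ w
  ∈-neighbours⁻ {v} {w} w∈N with v ~? w | trans (sym (lookup-neighbours v w)) ([]=⇒lookup w∈N)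
  ... | yes v~w | _ = v~w

  neighbours-sym : ∀ v w → lookup (neighbours G v) w ≡ lookup (neighbours G w) v
  neighbours-sym v w = trans (lookup-neighbours v w)
    (trans (does-⇔ (mk⇔ ~-sym ~-sym) (v ~? w) (w ~? v)) (sym (lookup-neighbours w v)))

  closedNeighbours : Fin n → Subset n
  closedNeighbours v = neighbours G v ∪ ⁅ v ⁆

  closedNeighbours-sym : ∀ v w → lookup (closedNeighbours v) w ≡ lookup (closedNeighbours w) v
  closedNeighbours-sym v w = begin
    lookup (closedNeighbours v) w                   ≡⟨ lookup-zipWith _∨_ w (neighbours G v) ⁅ v ⁆ ⟩
    lookup (neighbours G v) w ∨ lookup ⁅ v ⁆ w      ≡⟨ cong₂ _∨_ (neighbours-sym v w) (⁅⁆-sym v w) ⟩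
    lookup (neighbours G w) v ∨ lookup ⁅ w ⁆ v      ≡⟨ lookup-zipWith _∨_ v (neighbours G w) ⁅ w ⁆ ⟨
    lookup (closedNeighbours w) v                   ∎
    where open ≡-Reasoning

  -- The argument common to both parameters. Only `minimal` depends on the kind of domination: it
  -- says that a superset of a transversal whose complement has no isolated vertex competes in the
  -- minimum `γ`.
  transversal-bound : ∀ N d e c γ .{{_ : NonZero d}} → e ℕ.+ c ≡ d ℕ.+ 2 →
    (∀ {D X} → Meets N D → D ⊆ X → (∀ v → v ∉ X → ∃ λ u → u ∉ X × v ~ u) → γ ℕ.≤ ∣ X ∣) →
    Transversal N d →
    fromℕ γ ≤ᴿ (fromℕ 2 *ᴿ ln d +ᴿ fromℕ e +ᴿ fromℕ c) /ᴿ d *ᴿ fromℕ n -ᴿ fromℕ 2 *ᴿ fromℕ (β₁ G)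
  transversal-bound N d e c γ e+c≡d+2 minimal (D , meets , d∣D∣≤) =
    conclude (proj₁ (β₁-isGreatest G))
    where
    conclude : HasMatching G (β₁ G) →
      fromℕ γ ≤ᴿ (fromℕ 2 *ᴿ ln d +ᴿ fromℕ e +ᴿ fromℕ c) /ᴿ d *ᴿ fromℕ n -ᴿ fromℕ 2 *ᴿ fromℕ (β₁ G)
    conclude (M , matching) =
      let X , D⊆X , _ , partner , size = restrained-⊇ G M matching D
      in ≤-ln-bound n d e c {∣ D ∣} {∣ X ∣} {γ} {β₁ G} e+c≡d+2 d∣D∣≤ size (minimal meets D⊆X partner)

  module _ .{{_ : NonZero n}} where

    δ≤degree : ∀ v → δ G ℕ.≤ ∣ neighbours G v ∣
    δ≤degree v = proj₂ (δ-isLeast G) _ (v , refl)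

    1+δ≤∣closedNeighbours∣ : ∀ v → suc (δ G) ℕ.≤ ∣ closedNeighbours v ∣
    1+δ≤∣closedNeighbours∣ v = ℕ.≤-trans (ℕ.s≤s (δ≤degree v))
      (x∉p⇒1+∣p∣≤∣p∪⁅x⁆∣ (~-irrefl ∘ ∈-neighbours⁻))

    -- Closed neighbourhoods have at least δ + 1 elements. If `v` lies outside `X`, the `w` in `D`
    -- with `v` in its closed neighbourhood differs from `v`, as `D ⊆ X`, and so is a neighbour.
    γᵣ≤ : fromℕ (γᵣ G) ≤ᴿ
       (fromℕ 2 *ᴿ ln (suc (δ G)) +ᴿ fromℕ (δ G) +ᴿ fromℕ 3) /ᴿ suc (δ G) *ᴿ fromℕ n
         -ᴿ fromℕ 2 *ᴿ fromℕ (β₁ G)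
    γᵣ≤ = transversal-bound closedNeighbours (suc (δ G)) (δ G) 3 (γᵣ G) (ℕ.+-suc (δ G) 2)
      (λ {D} {X} meets D⊆X partner → proj₂ (γᵣ-isLeast G) ∣ X ∣ (X , (dominating meets D⊆X , partner) , refl))
      (transversal closedNeighbours closedNeighbours-sym 1+δ≤∣closedNeighbours∣)
      where
      dominating : ∀ {D X} → Meets closedNeighbours D → D ⊆ X → IsDominating G X
      dominating {X = X} meets D⊆X v v∉X with meets v
      ... | w , w∈D , v∈N[w] with x∈p∪q⁻ (neighbours G w) ⁅ w ⁆ v∈N[w]
      ...   | inj₁ v∈Nw = w , D⊆X w∈D , ~-sym (∈-neighbours⁻ v∈Nw)
      ...   | inj₂ v∈⁅w⁆ = contradiction (subst (_∈ X) (sym (x∈⁅y⁆⇒x≡y w v∈⁅w⁆)) (D⊆X w∈D)) v∉X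

    -- With open neighbourhoods every vertex, inside `X` or not, has a neighbour in `D ⊆ X`, so
    -- `neighbour` supplies domination and totality at once.
    γₜᵣ≤ : .{{_ : NonZero (δ G)}} → fromℕ (γₜᵣ G) ≤ᴿ
       (fromℕ 2 *ᴿ ln (δ G) +ᴿ fromℕ (δ G) +ᴿ fromℕ 2) /ᴿ δ G *ᴿ fromℕ n
         -ᴿ fromℕ 2 *ᴿ fromℕ (β₁ G)
    γₜᵣ≤ = transversal-bound (neighbours G) (δ G) (δ G) 2 (γₜᵣ G) refl
      (λ {D} {X} meets D⊆X partner → let nb = neighbour meets D⊆X in
        proj₂ (γₜᵣ-isLeast G) ∣ X ∣ (X , (((λ v _ → nb v) , partner) , λ v _ → nb v) , refl))
      (transversal (neighbours G) neighbours-sym δ≤degree)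
      where
      neighbour : ∀ {D X} → Meets (neighbours G) D → D ⊆ X → ∀ v → ∃ λ u → u ∈ X × v ~ u
      neighbour meets D⊆X v = let w , w∈D , v∈Nw = meets v in w , D⊆X w∈D , ~-sym (∈-neighbours⁻ v∈Nw)

theorem15 : ∀ {n : ℕ} .{{_ : NonZero n}} (G : Graph n) .{{_ : NonZero (δ G)}} →
    (fromℕ (γᵣ G) ≤ᴿ
    (fromℕ 2 *ᴿ ln (suc (δ G)) +ᴿ fromℕ (δ G) +ᴿ fromℕ 3) /ᴿ suc (δ G) *ᴿ fromℕ n
    -ᴿ fromℕ 2 *ᴿ fromℕ (β₁ G))
    ×
    (fromℕ (γₜᵣ G) ≤ᴿ
    (fromℕ 2 *ᴿ ln (δ G) +ᴿ fromℕ (δ G) +ᴿ fromℕ 2) /ᴿ δ G *ᴿ fromℕ n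
    -ᴿ fromℕ 2 *ᴿ fromℕ (β₁ G))
theorem15 G = γᵣ≤ G , γₜᵣ≤ G
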